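{- Let $k$ be a nonnegative integer, $n$ a positive integer, $x=(x_1,\dots,x_n)$ and $K=2k+1$. Then $$P^{\mathrm{B}_n}_{(k^n)}(x;1,0)=\sum_{y\in\mathbb{Z}^k}\det_{1\le i,j\le k}\Bigl((-1)^{y_i}\bigl(\dot e_{n-i+j-Ky_i}(x)+\dot e_{n+i+j-Ky_i-1}(x)\bigr)\Bigr)$$ and $$P^{\mathrm{BC}_n}_{(k^n)}(x;1,-1,0)=\sum_{y\in\mathbb{Z}^k}\det_{1\le i,j\le k}\Bigl((-1)^{y_i}\bigl(\dot e_{n-i+j-Ky_i}(x)-\dot e_{n+i+j-Ky_i}(x)\bigr)\Bigr).$$
   Context: $\dot e_r(x)=e_r(x_1,x_1^{ -1},\dots,x_n,x_n^{ -1})$ is the $r$-th elementary symmetric function in $2n$ variables, equal to $0$ for $r<0$ or $r>2n$. $(k^n)$ is the partition with $n$ parts equal to $k$. For $k=0$ the right-hand sides are $1$ (empty determinant). For a partition $\lambda$, $l(\lambda)$ is the number of parts and $m_i(\lambda)$ the multiplicity of parts equal to $i$; $(a;t)_m=\prod_{i=0}^{m-1}(1-at^i)$; $v_\lambda(t)=\frac{(t;t)_{n-l(\lambda)}}{(1-t)^{n-l(\lambda)}}\prod_{i\ge1}\frac{(t;t)_{m_i(\lambda)}}{(1-t)^{m_i(\lambda)}}$ (a polynomial in $t$, which is then evaluated at $t=1$). Let $W=S_n\ltimes(\mathbb{Z}/2\mathbb{Z})^n$ act on rational functions in $x$ by permuting the $x_i$ and by $x_i\mapsto x_i^{ -1}$.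 For $l(\lambda)\le n$ the $\mathrm{BC}_n$ Hall–Littlewood polynomial is $$P^{\mathrm{BC}_n}_{\lambda}(x;t,s_1,s_2)=\frac{1}{(s_1s_2;t)_{n-l(\lambda)}v_\lambda(t)}\sum_{w\in W}w\Biggl(\prod_{i=1}^n x_i^{ -\lambda_i}\frac{(1-s_1x_i)(1-s_2x_i)}{1-x_i^2}\prod_{1\le i<j\le n}\frac{(tx_i-x_j)(1-tx_ix_j)}{(x_i-x_j)(1-x_ix_j)}\Biggr),$$ and the $\mathrm{B}_n$ Hall–Littlewood polynomial is $P^{\mathrm{B}_n}_\lambda(x;t,s)=P^{\mathrm{BC}_n}_\lambda(x;t,s,-1)$. -}

module Defs where

open import Algebra.Bundles using (CommutativeRing; Semiring)
import Algebra.Definitions.RawSemiring as RawSemiringDefinitions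
import Algebra.Properties.CommutativeSemigroup as CommutativeSemigroupProperties
import Algebra.Properties.Ring as RingProperties
open import Data.Bool.Base using (if_then_else_)
open import Data.Fin.Base as Fin using (Fin; toℕ; punchIn)
import Data.Fin.Properties as Fin
open import Data.Fin.Permutation using (Permutation′; id; insert; _⟨$⟩ʳ_)
open import Data.Integer.Base as ℤ using (ℤ; +_; -[1+_]; ∣_∣)
open import Data.List.Base as List
  using (List; []; _∷_; _++_; length; filter; upTo; allFin; cartesianProduct; cartesianProductWith)
open import Data.Nat.Base as ℕ using (ℕ; zero; suc; _≤_; _<_; _∸_)
open import Data.Nat.Properties using (_≟_; _<?_; ≤-refl)
open import Data.Product.Base using (_×_; _,_; ∃)
open import Data.Sign.Base as Sign using (Sign)
open import Data.Vec.Base as Vec using (Vec; lookup)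
open import Data.Vec.Functional as Vector using (Vector)
open import Level as Level using (_⊔_)
open import Relation.Binary.PropositionalEquality using (_≡_; _≢_)
open import Relation.Nullary.Decidable.Core using (does)
open import Relation.Nullary.Negation.Core using (¬_)

-- The inverse is a total operation with an unconstrained value at 0, so that
-- rational expressions can be written without proofs that the denominators
-- are nonzero.  Those proofs are supplied separately (see Generic).
record Field c ℓ : Set (Level.suc (c ⊔ ℓ)) where
  infix 9 _⁻¹
  infixl 7 _/_
  field
    commutativeRing : CommutativeRing c ℓ
  open CommutativeRing commutativeRing public
  open Semiring semiring public using (rawSemiring)
  field
    _⁻¹      : Carrier → Carrier
    ⁻¹-cong  : ∀ {a b} → a ≈ b → a ⁻¹ ≈ b ⁻¹
    inverseʳ : ∀ {a} → ¬ (a ≈ 0#) → a * a ⁻¹ ≈ 1#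
    1≉0      : ¬ (1# ≈ 0#)

  _/_ : Carrier → Carrier → Carrier
  a / b = a * b ⁻¹

CharacteristicZero : ∀ {c ℓ} → Field c ℓ → Set ℓ
CharacteristicZero F = ∀ m → ¬ (ℕ.suc m · 1# ≈ 0#)
  where
  open Field F
  open RawSemiringDefinitions rawSemiring using () renaming (_×_ to _·_)

-- A partition with at most n parts, padded with zeros to n entries.
record Partition (n : ℕ) : Set where
  field
    part       : Vector ℕ n
    decreasing : ∀ {i j} → i Fin.≤ j → part j ≤ part i

  l : ℕ
  l = length (filter (0 <?_) (List.tabulate part))

  m : ℕ → ℕ
  m i = length (filter (_≟ i) (List.tabulate part))

  largest : ℕ
  largest = Vector.foldr ℕ._⊔_ 0 part

rectangle : ∀ k n → Partition n
rectangle k n = record { part = λ _ → k ; decreasing = λ _ → ≤-refl }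

tuples : ∀ {a} {A : Set a} → List A → ∀ n → List (Vec A n)
tuples as zero    = Vec.[] ∷ []
tuples as (suc n) = cartesianProductWith Vec._∷_ as (tuples as n)

-- All permutations of n points, each listed once: choose the image j of the
-- first point, then a permutation of the remaining ones.
permutations : ∀ n → List (Permutation′ n)
permutations zero    = id ∷ []
permutations (suc n) = cartesianProductWith (insert Fin.zero) (allFin (suc n)) (permutations n)

W : ℕ → Set
W n = Permutation′ n × Vec Sign n

elementsW : ∀ n → List (W n)
elementsW n = cartesianProduct (permutations n) (tuples (Sign.+ ∷ Sign.- ∷ []) n)

sublists : ∀ {a} {A : Set a} → List A → List (List A)
sublists []       = [] ∷ []
sublists (a ∷ as) = sublists as ++ List.map (a ∷_) (sublists as)

-- The position of an index, counted from 1.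
position : ∀ {k} → Fin k → ℤ
position i = + suc (toℕ i)

interval : ℕ → List ℤ
interval N = List.map (λ a → + a ℤ.- + N) (upTo (suc (2 ℕ.* N)))

module Over {c ℓ} (F : Field c ℓ) where
  open Field F
  open RawSemiringDefinitions rawSemiring using (_^_; sum; product)

  ∑[_] : ∀ {a} {A : Set a} → List A → (A → Carrier) → Carrier
  ∑[ as ] f = List.foldr _+_ 0# (List.map f as)

  -- f has finite support and its values over ℤᵏ add up to s.
  HasSum : ∀ {k} → (Vec ℤ k → Carrier) → Carrier → Set ℓ
  HasSum {k} f s = ∃ λ N →
    (∀ y → (∃ λ i → N < ∣ lookup y i ∣) → f y ≈ 0#) ×
    ∑[ tuples (interval N) k ] f ≈ s

  -- Expansion along the first row; the empty determinant is 1.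
  determinant : ∀ {k} → (Fin k → Fin k → Carrier) → Carrier
  determinant {zero}  M = 1#
  determinant {suc k} M = sum λ j →
    (- 1#) ^ toℕ j * M Fin.zero j * determinant (λ i j′ → M (Fin.suc i) (punchIn j j′))

  e : ℕ → List Carrier → Carrier
  e r zs = ∑[ filter (λ s → length s ≟ r) (sublists zs) ] (List.foldr _*_ 1#)

  ė : ∀ {n} → Vector Carrier n → ℤ → Carrier
  ė {n} x (+ r)    = e r (List.concatMap (λ i → x i ∷ x i ⁻¹ ∷ []) (allFin n))
  ė {n} x -[1+ _ ] = 0#

  -- (a;t)_m
  pochhammer : Carrier → Carrier → ℕ → Carrier
  pochhammer a t m = product {m} λ i → 1# - a * t ^ toℕ i

  geometric : ℕ → Carrier → Carrier
  geometric m t = sum {m} λ j → t ^ toℕ j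

  -- The polynomial (t;t)_m / (1 - t)^m, with the division carried out in each
  -- factor so that it can be evaluated at t = 1; see qFactorial-correct.
  qFactorial : ℕ → Carrier → Carrier
  qFactorial m t = product {m} λ i → geometric (suc (toℕ i)) t

  -- Parts exceeding the largest one have multiplicity 0 and contribute 1.
  v : ∀ {n} → Partition n → Carrier → Carrier
  v {n} μ t =
    qFactorial (n ∸ l) t * product {largest} λ i → qFactorial (m (suc (toℕ i))) t
    where open Partition μ

  -- Rational functions in x₁, …, xₙ are given by their values; a group element
  -- acts on them by substitution for the variables.
  act : ∀ {n} → W n → (Vector Carrier n → Carrier) → Vector Carrier n → Carrier
  act (σ , ε) f x = f λ i → power (lookup ε i) (x (σ ⟨$⟩ʳ i))
    where
    power : Sign → Carrier → Carrier
    power Sign.+ a = a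
    power Sign.- a = a ⁻¹

  P-BC : ∀ {n} → Partition n → Vector Carrier n → (t s₁ s₂ : Carrier) → Carrier
  P-BC {n} μ x t s₁ s₂ =
    (pochhammer (s₁ * s₂) t (n ∸ l) * v μ t) ⁻¹ * ∑[ elementsW n ] (λ w → act w summand x)
    where
    open Partition μ
    summand : Vector Carrier n → Carrier
    summand x =
      product (λ i → (x i ⁻¹) ^ part i * ((1# - s₁ * x i) * (1# - s₂ * x i) / (1# - x i ^ 2)))
      * product (λ i → product (λ j →
          if does (i Fin.<? j)
          then (t * x i - x j) * (1# - t * x i * x j) / ((x i - x j) * (1# - x i * x j))
          else 1#))

  P-B : ∀ {n} → Partition n → Vector Carrier n → (t s : Carrier) → Carrier
  P-B μ x t s = P-BC μ x t s (- 1#)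

  -- None of the denominators in P-BC, nor any of their images under W, vanishes
  -- at x.  This holds when the entries of x are independent indeterminates.
  record Generic {n} (x : Vector Carrier n) : Set ℓ where
    field
      xᵢ≉0    : ∀ i → ¬ (x i ≈ 0#)
      xᵢ²≉1   : ∀ i → ¬ (x i ^ 2 ≈ 1#)
      xᵢ≉xⱼ   : ∀ i j → i ≢ j → ¬ (x i ≈ x j)
      xᵢxⱼ≉1  : ∀ i j → i ≢ j → ¬ (x i * x j ≈ 1#)

  private
    open RingProperties ring using (-‿distribʳ-*)
    open CommutativeSemigroupProperties *-commutativeSemigroup using (interchange)
    open import Relation.Binary.Reasoning.Setoid setoid
    open import Algebra.Properties.Semiring.Sum semiring using (*-distribˡ-sum)

    geometric-correct : ∀ m t → geometric m t * (1# - t) ≈ 1# - t ^ m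
    geometric-correct zero    t = trans (zeroˡ _) (sym (-‿inverseʳ 1#))
    geometric-correct (suc m) t = begin
      (1# + sum {m} (λ j → t * t ^ toℕ j)) * (1# - t)
        ≈⟨ *-congʳ (+-congˡ (*-distribˡ-sum {m} t (λ j → t ^ toℕ j))) ⟨
      (1# + t * geometric m t) * (1# - t)
        ≈⟨ distribʳ _ _ _ ⟩
      1# * (1# - t) + t * geometric m t * (1# - t)
        ≈⟨ +-cong (*-identityˡ _) (trans (*-assoc _ _ _) (*-congˡ (geometric-correct m t))) ⟩
      (1# - t) + t * (1# - t ^ m)
        ≈⟨ +-congˡ (trans (distribˡ _ _ _) (+-cong (*-identityʳ t) (sym (-‿distribʳ-* _ _)))) ⟩
      (1# - t) + (t - t * t ^ m)
        ≈⟨ +-assoc _ _ _ ⟩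
      1# + (- t + (t - t * t ^ m))
        ≈⟨ +-congˡ (+-assoc _ _ _) ⟨
      1# + ((- t + t) - t * t ^ m)
        ≈⟨ +-congˡ (trans (+-congʳ (-‿inverseˡ t)) (+-identityˡ _)) ⟩
      1# - t * t ^ m ∎

    product-scale : ∀ {m} (f g : Vector Carrier m) a → (∀ i → f i * a ≈ g i) →
                    product f * a ^ m ≈ product g
    product-scale {zero}  f g a h = *-identityʳ 1#
    product-scale {suc m} f g a h =
      trans (interchange _ _ _ _)
        (*-cong (h Fin.zero)
          (product-scale {m} (λ i → f (Fin.suc i)) (λ i → g (Fin.suc i)) a (λ i → h (Fin.suc i))))

  qFactorial-correct : ∀ m t → qFactorial m t * (1# - t) ^ m ≈ pochhammer t t m
  qFactorial-correct m t =
    product-scale {m} (λ i → geometric (suc (toℕ i)) t) (λ i → 1# - t * t ^ toℕ i) (1# - t)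
      (λ i → geometric-correct (suc (toℕ i)) t)

{-# OPTIONS --safe #-}

-- At t = 1 the pair factors in P^BC cancel, so both left-hand sides equal ∏ᵢ ψ(xᵢ)
-- with (1 - z) ψ(z) = z⁻ᵏ - z^(k+1).  On the right, the determinant is linear in
-- its rows and row i only depends on yᵢ, so the sum can be carried out inside: the
-- entries become b(j - i) ± b(j + i - d) with b(r) = ∑_y (-1)^y ė_{n+r-Ky}, which is
-- even and satisfies b(r + K) = - b(r).  Adjoining a variable z replaces b(r) by
-- b(r + 1) + (z + z⁻¹) b(r) + b(r - 1), which by these two symmetries multiplies the
-- matrix by a tridiagonal one; the determinant of the latter is ψ(z).

module Submission where

open import Defs
open import Algebra.Bundles using (CommutativeRing)
import Algebra.Definitions.RawSemiring as RawSemiringDefinitions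
import Algebra.Properties.AbelianGroup as AbelianGroupProperties
import Algebra.Properties.CommutativeMonoid.Sum as CommutativeMonoidSum
import Algebra.Properties.Ring as RingProperties
import Algebra.Properties.Semiring.Mult.TCOptimised as Multiples
import Algebra.Properties.Semiring.Sum as SemiringSum
import Algebra.Solver.Ring as RingSolver
open import Algebra.Solver.Ring.AlmostCommutativeRing using (fromCommutativeRing; _-Raw-AlmostCommutative⟶_)
open import Data.Bool.Base using (true; false; if_then_else_)
open import Data.Empty using (⊥)
open import Data.Fin.Base as Fin using (Fin; zero; suc; toℕ; fromℕ; inject₁; punchIn)
open import Data.Fin.Permutation as Permutation using (_⟨$⟩ʳ_; _⟨$⟩ˡ_)
import Data.Fin.Properties as Fin
open import Data.Integer.Base as ℤ using (ℤ; +_; -[1+_]; _⊖_; ∣_∣)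
import Data.Integer.Properties as ℤ
import Data.Integer.Solver as ℤ
open import Data.List.Base as List using (List; []; _∷_; _++_; length; filter; applyUpTo; upTo; allFin; cartesianProductWith)
import Data.List.Properties as List
open import Data.Maybe.Base using (Maybe; just; nothing)
open import Data.Nat.Base as ℕ using (ℕ; zero; suc; _≤_; _<_; z≤n; s≤s)
import Data.Nat.Properties as ℕ
open import Data.Product.Base using (_×_; _,_; ∃; proj₁; proj₂)
open import Data.Sign.Base as Sign using (Sign)
open import Data.Vec.Base as Vec using (Vec; []; _∷_; lookup; tabulate)
open import Data.Vec.Functional as Vector using (Vector)
import Data.Vec.Properties as Vec
open import Data.Vec.Relation.Binary.Pointwise.Inductive as Pointwise using (Pointwise; []; _∷_)
open import Function.Base using (_∘_; id)
open import Level using (Lift; _⊔_)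
open import Relation.Binary.PropositionalEquality.Core as ≡ using (_≡_; _≢_)
open import Relation.Nullary.Decidable using (Dec; yes; no; does; dec-true; dec-false)
open import Relation.Nullary.Negation using (¬_; contradiction)

-- Multiplication by the tridiagonal matrix turns column j into a combination of the columns j - 1,
-- j and j + 1, so for j = 1 and j = k each row needs a value outside the matrix. The period K = 2k
-- + 1 is the one for which the symmetries of b supply these values: of the columns 0 and k + 1, one
-- vanishes and the other repeats its neighbour inside. The repeated one is the extra 1 in a corner
-- of the tridiagonal matrix, and the two identities differ in which corner it is. The two matrices
-- are reversals of each other and share the determinant ψ(z), the sum of the powers of z from -k to
-- k. This agrees with the left-hand sides, which coincide because P^BC is symmetric in its last two
-- parameters. The sum defining b has to be truncated to the y with |y| at most N. Evenness survives
-- every symmetric truncation, but antiperiodicity survives only where the boundary terms vanish.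
-- Hence the bound `n + 2 * k < N`; it is inherited when variables are removed, so one N serves the
-- whole induction.

-- The canonical map from the integers to a commutative ring.

-- Integer coefficients let the ring solver recognise cancellations although
-- equality in R is not decidable.
module IntegerCoefficients {c ℓ} (R : CommutativeRing c ℓ) where
  open CommutativeRing R
  open Multiples semiring using (×-homo-+; ×1-homo-*; 1+×) renaming (_×_ to _·_)
  open RingProperties ring using (-‿distribˡ-*; -‿distribʳ-*; -‿involutive)
  open AbelianGroupProperties +-abelianGroup using (⁻¹-∙-comm; ε⁻¹≈ε)
  open import Relation.Binary.Reasoning.Setoid setoid

  -- With the optimised multiples, `⟦ + 1 ⟧` is `1#` by definition, so `con (+ 1)` matches the
  -- literal `1#` in a goal.
  ⟦_⟧ : ℤ → Carrier
  ⟦ + n ⟧      = n · 1#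
  ⟦ -[1+ n ] ⟧ = - (suc n · 1#)

  ⟦⟧-⊖ : ∀ m n → ⟦ m ⊖ n ⟧ ≈ m · 1# - n · 1#
  ⟦⟧-⊖ m       zero    = sym (trans (+-congˡ ε⁻¹≈ε) (+-identityʳ _))
  ⟦⟧-⊖ zero    (suc n) = sym (+-identityˡ _)
  ⟦⟧-⊖ (suc m) (suc n) = begin
    ⟦ suc m ⊖ suc n ⟧                    ≡⟨ ≡.cong ⟦_⟧ (ℤ.[1+m]⊖[1+n]≡m⊖n m n) ⟩
    ⟦ m ⊖ n ⟧                            ≈⟨ ⟦⟧-⊖ m n ⟩
    m · 1# - n · 1#                      ≈⟨ +-congʳ (+-identityʳ _) ⟨
    m · 1# + 0# - n · 1#                 ≈⟨ +-congʳ (+-congˡ (-‿inverseʳ 1#)) ⟨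
    m · 1# + (1# - 1#) - n · 1#          ≈⟨ +-congʳ (trans (sym (+-assoc _ _ _)) (+-congʳ (+-comm _ _))) ⟩
    1# + m · 1# - 1# - n · 1#            ≈⟨ +-assoc _ _ _ ⟩
    1# + m · 1# + (- 1# - n · 1#)        ≈⟨ +-congˡ (⁻¹-∙-comm _ _) ⟩
    1# + m · 1# - (1# + n · 1#)          ≈⟨ +-cong (1+× m 1#) (-‿cong (1+× n 1#)) ⟨
    suc m · 1# - suc n · 1#              ∎

  ⟦⟧-neg : ∀ i → ⟦ ℤ.- i ⟧ ≈ - ⟦ i ⟧
  ⟦⟧-neg (+ zero)   = sym ε⁻¹≈ε
  ⟦⟧-neg (+ suc n)  = refl
  ⟦⟧-neg -[1+ n ]   = sym (-‿involutive _)

  ⟦⟧-+ : ∀ i j → ⟦ i ℤ.+ j ⟧ ≈ ⟦ i ⟧ + ⟦ j ⟧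
  ⟦⟧-+ (+ m)    (+ n)    = ×-homo-+ 1# m n
  ⟦⟧-+ (+ m)    -[1+ n ] = ⟦⟧-⊖ m (suc n)
  ⟦⟧-+ -[1+ m ] (+ n)    = trans (⟦⟧-⊖ n (suc m)) (+-comm _ _)
  ⟦⟧-+ -[1+ m ] -[1+ n ] = begin
    - (suc (suc (m ℕ.+ n)) · 1#)         ≡⟨ ≡.cong (λ l → - (suc l · 1#)) (ℕ.+-suc m n) ⟨
    - ((suc m ℕ.+ suc n) · 1#)           ≈⟨ -‿cong (×-homo-+ 1# (suc m) (suc n)) ⟩
    - (suc m · 1# + suc n · 1#)          ≈⟨ ⁻¹-∙-comm _ _ ⟨
    - (suc m · 1#) - suc n · 1#          ∎

  ⟦⟧-+* : ∀ m n → ⟦ + m ℤ.* + n ⟧ ≈ ⟦ + m ⟧ * ⟦ + n ⟧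
  ⟦⟧-+* m n = trans (reflexive (≡.cong ⟦_⟧ (≡.sym (ℤ.pos-* m n)))) (×1-homo-* m n)

  ⟦⟧-* : ∀ i j → ⟦ i ℤ.* j ⟧ ≈ ⟦ i ⟧ * ⟦ j ⟧
  ⟦⟧-* (+ m)    (+ n)    = ⟦⟧-+* m n
  ⟦⟧-* (+ m)    -[1+ n ] = begin
    ⟦ + m ℤ.* -[1+ n ] ⟧                 ≡⟨ ≡.cong ⟦_⟧ (ℤ.neg-distribʳ-* (+ m) (+ suc n)) ⟨
    ⟦ ℤ.- (+ m ℤ.* + suc n) ⟧            ≈⟨ ⟦⟧-neg (+ m ℤ.* + suc n) ⟩
    - ⟦ + m ℤ.* + suc n ⟧                ≈⟨ -‿cong (⟦⟧-+* m (suc n)) ⟩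
    - (⟦ + m ⟧ * ⟦ + suc n ⟧)            ≈⟨ -‿distribʳ-* _ _ ⟩
    ⟦ + m ⟧ * ⟦ -[1+ n ] ⟧               ∎
  ⟦⟧-* -[1+ m ] (+ n)    = begin
    ⟦ -[1+ m ] ℤ.* + n ⟧                 ≡⟨ ≡.cong ⟦_⟧ (ℤ.neg-distribˡ-* (+ suc m) (+ n)) ⟨
    ⟦ ℤ.- (+ suc m ℤ.* + n) ⟧            ≈⟨ ⟦⟧-neg (+ suc m ℤ.* + n) ⟩
    - ⟦ + suc m ℤ.* + n ⟧                ≈⟨ -‿cong (⟦⟧-+* (suc m) n) ⟩
    - (⟦ + suc m ⟧ * ⟦ + n ⟧)            ≈⟨ -‿distribˡ-* _ _ ⟩
    ⟦ -[1+ m ] ⟧ * ⟦ + n ⟧               ∎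
  ⟦⟧-* -[1+ m ] -[1+ n ] = begin
    ⟦ + suc m ℤ.* + suc n ⟧              ≈⟨ ⟦⟧-+* (suc m) (suc n) ⟩
    ⟦ + suc m ⟧ * ⟦ + suc n ⟧            ≈⟨ -‿involutive _ ⟨
    - - (⟦ + suc m ⟧ * ⟦ + suc n ⟧)      ≈⟨ -‿cong (-‿distribʳ-* _ _) ⟩
    - (⟦ + suc m ⟧ * ⟦ -[1+ n ] ⟧)       ≈⟨ -‿distribˡ-* _ _ ⟩
    ⟦ -[1+ m ] ⟧ * ⟦ -[1+ n ] ⟧          ∎

  morphism : ℤ.+-*-rawRing -Raw-AlmostCommutative⟶ fromCommutativeRing R
  morphism = record
    { ⟦_⟧    = ⟦_⟧
    ; +-homo = ⟦⟧-+
    ; *-homo = ⟦⟧-*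
    ; -‿homo = ⟦⟧-neg
    ; 0-homo = refl
    ; 1-homo = refl
    }

  ⟦⟧-≟ : ∀ i j → Maybe (⟦ i ⟧ ≈ ⟦ j ⟧)
  ⟦⟧-≟ i j with i ℤ.≟ j
  ... | yes ≡.refl = just refl
  ... | no  _      = nothing

  open RingSolver ℤ.+-*-rawRing (fromCommutativeRing R) morphism ⟦⟧-≟ public
    using (solve; _:=_; _:+_; _:*_; _:-_; :-_; con)

-- Alternating multilinear forms and the multiplicativity of the determinant.

module Determinants {c ℓ} (F : Field c ℓ) where
  open Field F hiding (zero)
  open Over F
  open RawSemiringDefinitions rawSemiring using (_^_; sum)
  open AbelianGroupProperties +-abelianGroup using (inverseˡ-unique)
  module Sum = SemiringSum semiring
  open IntegerCoefficients commutativeRing using (solve; _:=_; _:+_; _:*_; :-_; con)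
  open import Relation.Binary.Reasoning.Setoid setoid

  infix 4 _≐_
  _≐_ : ∀ {m} → Vector Carrier m → Vector Carrier m → Set ℓ
  u ≐ v = ∀ i → u i ≈ v i

  Pointwise-≐-refl : ∀ {m k} {vs : Vec (Vector Carrier m) k} → Pointwise _≐_ vs vs
  Pointwise-≐-refl = Pointwise.refl (λ _ → refl)

  -- A form of a single argument has nothing to compare it with, so on the empty tail the condition
  -- is false and `vanishing` demands nothing.
  StartsWith : ∀ {m k} → Vector Carrier m → Vec (Vector Carrier m) k → Set ℓ
  StartsWith u []      = Lift ℓ ⊥
  StartsWith u (v ∷ _) = u ≐ v

  infixl 6 _+ᵥ_
  _+ᵥ_ : ∀ {m} → Vector Carrier m → Vector Carrier m → Vector Carrier m
  (u +ᵥ v) i = u i + v i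

  infixr 7 _*ᵥ_
  _*ᵥ_ : ∀ {m} → Carrier → Vector Carrier m → Vector Carrier m
  (a *ᵥ u) i = a * u i

  Form : ℕ → ℕ → Set c
  Form m k = Vec (Vector Carrier m) k → Carrier

  Congruent : ∀ {m k} → Form m k → Set (c ⊔ ℓ)
  Congruent D = ∀ {vs ws} → Pointwise _≐_ vs ws → D vs ≈ D ws

  -- The conditions only concern the first two arguments and are imposed again
  -- on the form that remains when the first argument is fixed.
  data Alternating {m} : ∀ {k} → Form m k → Set (c ⊔ ℓ) where
    nullary : {D : Form m 0} → Congruent D → Alternating D
    curried : ∀ {k} {D : Form m (suc k)} → Congruent D →
              (∀ u v ws → D (u +ᵥ v ∷ ws) ≈ D (u ∷ ws) + D (v ∷ ws)) →
              (∀ a u ws → D (a *ᵥ u ∷ ws) ≈ a * D (u ∷ ws)) →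
              (∀ u ws → StartsWith u ws → D (u ∷ ws) ≈ 0#) →
              (∀ u → Alternating (λ ws → D (u ∷ ws))) →
              Alternating D

  congruent : ∀ {m k} {D : Form m k} → Alternating D → Congruent D
  congruent (nullary D-cong)         = D-cong
  congruent (curried D-cong _ _ _ _) = D-cong

  additive : ∀ {m k} {D : Form m (suc k)} → Alternating D →
             ∀ u v ws → D (u +ᵥ v ∷ ws) ≈ D (u ∷ ws) + D (v ∷ ws)
  additive (curried _ D-+ _ _ _) = D-+

  homogeneous : ∀ {m k} {D : Form m (suc k)} → Alternating D →
                ∀ a u ws → D (a *ᵥ u ∷ ws) ≈ a * D (u ∷ ws)
  homogeneous (curried _ _ D-* _ _) = D-*

  vanishing : ∀ {m k} {D : Form m (suc k)} → Alternating D →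
              ∀ u ws → StartsWith u ws → D (u ∷ ws) ≈ 0#
  vanishing (curried _ _ _ D-0 _) = D-0

  fixed : ∀ {m k} {D : Form m (suc k)} → Alternating D → ∀ u → Alternating (λ ws → D (u ∷ ws))
  fixed (curried _ _ _ _ D-∷) = D-∷

  Alternating-resp-≈ : ∀ {m k} {D E : Form m k} → (∀ vs → E vs ≈ D vs) → Alternating D → Alternating E
  Alternating-resp-≈ {E = E} eq (nullary D-cong) =
    nullary {D = E} λ vs≐ws → trans (eq _) (trans (D-cong vs≐ws) (sym (eq _)))
  Alternating-resp-≈ eq (curried D-cong D-+ D-* D-0 D-∷) = curried
    (λ vs≐ws → trans (eq _) (trans (D-cong vs≐ws) (sym (eq _))))
    (λ u v ws → trans (eq _) (trans (D-+ u v ws) (sym (+-cong (eq _) (eq _)))))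
    (λ a u ws → trans (eq _) (trans (D-* a u ws) (sym (*-congˡ (eq _)))))
    (λ u ws s → trans (eq _) (D-0 u ws s))
    (λ u → Alternating-resp-≈ (λ ws → eq (u ∷ ws)) (D-∷ u))

  StartsWith-map : ∀ {m m′ k} (f : Fin m′ → Fin m) {u} (vs : Vec (Vector Carrier m) k) →
                   StartsWith u vs → StartsWith (u ∘ f) (Vec.map (_∘ f) vs)
  StartsWith-map f (v ∷ vs) u≐v = u≐v ∘ f

  Pointwise-map : ∀ {m m′ k} (f : Fin m′ → Fin m) {vs ws : Vec (Vector Carrier m) k} →
                  Pointwise _≐_ vs ws → Pointwise _≐_ (Vec.map (_∘ f) vs) (Vec.map (_∘ f) ws)
  Pointwise-map f []            = []
  Pointwise-map f (v≐w ∷ vs≐ws) = (v≐w ∘ f) ∷ Pointwise-map f vs≐ws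

  sum-cong : ∀ {n} {f g : Vector Carrier n} → (∀ i → f i ≈ g i) → sum f ≈ sum g
  sum-cong = Sum.sum-cong-≋

  sum-+ : ∀ {n} (f g : Vector Carrier n) → sum (λ i → f i + g i) ≈ sum f + sum g
  sum-+ = Sum.∑-distrib-+

  *-sum : ∀ {n} a (f : Vector Carrier n) → a * sum f ≈ sum (λ i → a * f i)
  *-sum = Sum.*-distribˡ-sum

  sum-remove : ∀ {n} i (f : Vector Carrier (suc n)) → sum f ≈ f i + sum (f ∘ punchIn i)
  sum-remove i f = Sum.sum-remove {i = i} f

  sum-zero : ∀ {n} {f : Vector Carrier n} → (∀ i → f i ≈ 0#) → sum f ≈ 0#
  sum-zero {n} f≈0 = trans (sum-cong f≈0) (Sum.sum-replicate-zero n)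

  sum-*-+ : ∀ {n} (a : Vector Carrier n) {f g h : Vector Carrier n} → (∀ i → f i ≈ g i + h i) →
            sum (λ i → a i * f i) ≈ sum (λ i → a i * g i) + sum (λ i → a i * h i)
  sum-*-+ a {f} {g} {h} eq =
    trans (sum-cong λ i → trans (*-congˡ (eq i)) (distribˡ _ _ _)) (sum-+ (λ i → a i * g i) (λ i → a i * h i))

  sum-*-* : ∀ {n} (a : Vector Carrier n) {f g : Vector Carrier n} b → (∀ i → f i ≈ b * g i) →
            sum (λ i → a i * f i) ≈ b * sum (λ i → a i * g i)
  sum-*-* a {f} {g} b eq = trans
    (sum-cong λ i → trans (*-congˡ (eq i)) (solve 3 (λ a b g → a :* (b :* g) := b :* (a :* g)) refl (a i) b (g i)))
    (sym (*-sum b (λ i → a i * g i)))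

  -- With its first row fixed, a determinant is a linear combination of minors, that is, of smaller
  -- determinants applied to rows with one coordinate deleted; this carries the induction in
  -- `det-Alternating`. The form may depend on `j` because fixing a further argument `u` fixes
  -- `u ∘ f j` in the `j`-th summand.
  sum-Alternating : ∀ {m m′ n k} (a : Vector Carrier n) (f : Fin n → Fin m′ → Fin m) (D : Fin n → Form m′ k) →
                    (∀ j → Alternating (D j)) →
                    Alternating {m} (λ vs → sum λ j → a j * D j (Vec.map (_∘ f j) vs))
  sum-Alternating {k = zero} a f D alt = nullary
    λ vs≐ws → sum-cong λ j → *-congˡ (congruent (alt j) (Pointwise-map (f j) vs≐ws))
  sum-Alternating {k = suc k} a f D alt = curried
    (λ vs≐ws → sum-cong λ j → *-congˡ (congruent (alt j) (Pointwise-map (f j) vs≐ws)))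
    (λ u v ws → sum-*-+ a λ j → additive (alt j) (u ∘ f j) (v ∘ f j) _)
    (λ b u ws → sum-*-* a b λ j → homogeneous (alt j) b (u ∘ f j) _)
    (λ u ws s → sum-zero λ j →
      trans (*-congˡ (vanishing (alt j) (u ∘ f j) _ (StartsWith-map (f j) ws s))) (zeroʳ _))
    (λ u → sum-Alternating a f (λ j ws → D j (u ∘ f j ∷ ws)) (λ j → fixed (alt j) (u ∘ f j)))

  det : ∀ {k} → Form k k
  det vs = determinant (lookup vs)

  sign : ∀ {k} → Fin k → Carrier
  sign j = (- 1#) ^ toℕ j

  determinant-cong : ∀ {k} {M N : Fin k → Fin k → Carrier} → (∀ i j → M i j ≈ N i j) →
                     determinant M ≈ determinant N
  determinant-cong {zero}  eq = refl
  determinant-cong {suc k} eq = sum-cong λ j →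
    *-cong (*-congˡ {sign j} (eq zero j)) (determinant-cong λ i j′ → eq (suc i) (punchIn j j′))

  det-cong : ∀ {k} → Congruent (det {k})
  det-cong vs≐ws = determinant-cong (Pointwise.lookup vs≐ws)

  det-∷ : ∀ {k} (u : Vector Carrier (suc k)) vs →
          det (u ∷ vs) ≈ sum λ j → (sign j * u j) * det (Vec.map (_∘ punchIn j) vs)
  det-∷ u vs = sum-cong λ j → *-congˡ {sign j * u j} (determinant-cong λ i j′ →
    reflexive (≡.sym (≡.cong (λ v → v j′) (Vec.lookup-map i (_∘ punchIn j) vs))))

  -- The pairs (i, j) with i ≤ j are matched with the pairs (j + 1, i).
  sum-cancel : ∀ {n} (f : Fin (suc n) → Fin n → Carrier) →
               (∀ i j → toℕ i ℕ.≤ toℕ j → f (inject₁ i) j + f (suc j) i ≈ 0#) →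
               sum (λ i → sum (f i)) ≈ 0#
  sum-cancel {zero}  f h = +-identityˡ 0#
  sum-cancel {suc n} f h = begin
    sum (f zero) + sum (λ i → f (suc i) zero + sum (f (suc i) ∘ suc))
      ≈⟨ +-congˡ (sum-+ (λ i → f (suc i) zero) (λ i → sum (f (suc i) ∘ suc))) ⟩
    sum (f zero) + (sum (λ i → f (suc i) zero) + sum (λ i → sum (f (suc i) ∘ suc)))
      ≈⟨ +-congˡ (trans (+-congˡ (sum-cancel (λ i j → f (suc i) (suc j)) (λ i j i≤j → h (suc i) (suc j) (s≤s i≤j)))) (+-identityʳ _)) ⟩
    sum (f zero) + sum (λ i → f (suc i) zero)
      ≈⟨ sum-+ (f zero) (λ i → f (suc i) zero) ⟨
    sum (λ j → f zero j + f (suc j) zero)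
      ≈⟨ sum-zero (λ j → h zero j z≤n) ⟩
    0# ∎

  punchIn-inject₁ : ∀ {n} (i j : Fin n) → toℕ i ℕ.≤ toℕ j → punchIn (inject₁ i) j ≡ suc j
  punchIn-inject₁ zero    j       _         = ≡.refl
  punchIn-inject₁ (suc i) (suc j) (s≤s i≤j) = ≡.cong suc (punchIn-inject₁ i j i≤j)

  punchIn-suc : ∀ {n} (i j : Fin n) → toℕ i ℕ.≤ toℕ j → punchIn (suc j) i ≡ inject₁ i
  punchIn-suc zero    j       _         = ≡.refl
  punchIn-suc (suc i) (suc j) (s≤s i≤j) = ≡.cong suc (punchIn-suc i j i≤j)

  punchIn-comm : ∀ {n} (i j : Fin (suc n)) (l : Fin n) → toℕ i ℕ.≤ toℕ j →
                 punchIn (inject₁ i) (punchIn j l) ≡ punchIn (suc j) (punchIn i l)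
  punchIn-comm zero    j       l       _         = ≡.refl
  punchIn-comm (suc i) (suc j) zero    _         = ≡.refl
  punchIn-comm (suc i) (suc j) (suc l) (s≤s i≤j) = ≡.cong suc (punchIn-comm i j l i≤j)

  -- Expansion along the first two rows gives a sum over ordered pairs of distinct columns.
  -- Exchanging the two columns leaves the minor unchanged and, as the rows agree, also the product
  -- of the entries. The sign flips: the larger column counts as `j + 1` when it is deleted first
  -- and as `j` when it is deleted second.
  det-repeated : ∀ {k} (u v : Vector Carrier (suc (suc k))) vs → u ≐ v → det (u ∷ v ∷ vs) ≈ 0#
  det-repeated u v vs u≐v = trans
    (sum-cong λ i → *-sum (sign i * u i) (λ j → sign j * v (punchIn i j) * minor i j))
    (sum-cancel (λ i j → sign i * u i * (sign j * v (punchIn i j) * minor i j)) cancel)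
    where
    minor : ∀ i j → Carrier
    minor i j = determinant λ l l′ → lookup vs l (punchIn i (punchIn j l′))

    cancel : ∀ i j → toℕ i ℕ.≤ toℕ j →
             sign (inject₁ i) * u (inject₁ i) * (sign j * v (punchIn (inject₁ i) j) * minor (inject₁ i) j)
               + sign (suc j) * u (suc j) * (sign i * v (punchIn (suc j) i) * minor (suc j) i) ≈ 0#
    cancel i j i≤j = begin
      sign (inject₁ i) * u (inject₁ i) * (sign j * v (punchIn (inject₁ i) j) * minor (inject₁ i) j)
        + sign (suc j) * u (suc j) * (sign i * v (punchIn (suc j) i) * minor (suc j) i)
        ≈⟨ +-cong
             (*-cong (*-cong (reflexive (≡.cong ((- 1#) ^_) (Fin.toℕ-inject₁ i))) (u≐v (inject₁ i)))
               (*-cong (*-congˡ (sym (trans (u≐v (suc j)) (reflexive (≡.cong v (≡.sym (punchIn-inject₁ i j i≤j)))))))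
                 (determinant-cong λ l l′ → reflexive (≡.cong (lookup vs l) (punchIn-comm i j l′ i≤j)))))
             (*-congˡ (*-congʳ (*-congˡ (reflexive (≡.cong v (punchIn-suc i j i≤j)))))) ⟩
      sign i * v (inject₁ i) * (sign j * u (suc j) * minor (suc j) i)
        + (- 1# * sign j) * u (suc j) * (sign i * v (inject₁ i) * minor (suc j) i)
        ≈⟨ solve 5 (λ s t a b d → s :* a :* (t :* b :* d) :+ (:- con (+ 1) :* t) :* b :* (s :* a :* d) := con (+ 0))
             refl (sign i) (sign j) (v (inject₁ i)) (u (suc j)) (minor (suc j) i) ⟩
      0# ∎

  det-Alternating : ∀ {k} → Alternating (det {k})
  det-Alternating {zero}  = nullary det-cong
  det-Alternating {suc k} = curried det-cong
    (λ u v ws → trans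
      (sum-cong λ j → solve 4 (λ s u v d → s :* (u :+ v) :* d := s :* u :* d :+ s :* v :* d)
        refl (sign j) (u j) (v j) (minor ws j))
      (sum-+ (λ j → sign j * u j * minor ws j) (λ j → sign j * v j * minor ws j)))
    (λ a u ws → trans
      (sum-cong λ j → solve 4 (λ s a u d → s :* (a :* u) :* d := a :* (s :* u :* d))
        refl (sign j) a (u j) (minor ws j))
      (sym (*-sum a (λ j → sign j * u j * minor ws j))))
    vanish
    (λ u → Alternating-resp-≈ (det-∷ u)
      (sum-Alternating (λ j → sign j * u j) punchIn (λ _ → det) (λ _ → det-Alternating)))
    where
    minor : Vec (Vector Carrier (suc k)) k → Fin (suc k) → Carrier
    minor ws j = determinant λ i j′ → lookup ws i (punchIn j j′)

    vanish : ∀ {k} (u : Vector Carrier (suc k)) (ws : Vec _ k) → StartsWith u ws → det (u ∷ ws) ≈ 0#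
    vanish u (v ∷ ws) = det-repeated u v ws

  zero-head : ∀ {m k} {D : Form m (suc k)} → Alternating D → ∀ ws → D ((λ _ → 0#) ∷ ws) ≈ 0#
  zero-head alt ws = trans (congruent alt ((λ _ → sym (zeroˡ 0#)) ∷ Pointwise-≐-refl))
    (trans (homogeneous alt 0# _ ws) (zeroˡ _))

  zero-argument : ∀ {m k} {D : Form m k} → Alternating D → ∀ vs i → lookup vs i ≐ (λ _ → 0#) → D vs ≈ 0#
  zero-argument alt (v ∷ vs) zero    v≐0 = trans (congruent alt (v≐0 ∷ Pointwise-≐-refl)) (zero-head alt vs)
  zero-argument alt (v ∷ vs) (suc i) v≐0 = zero-argument (fixed alt v) vs i v≐0

  -- The row `a` times the matrix with rows `B`, so `λ i → combination (A i) B` is the matrix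
  -- product of `A` and `B`.
  combination : ∀ {m n} → Vector Carrier n → (Fin n → Vector Carrier m) → Vector Carrier m
  combination a B i = sum λ j → a j * B j i

  combination-head : ∀ {m n k} {D : Form m (suc k)} → Alternating D → ∀ (a : Vector Carrier n) B ws →
                     D (combination a B ∷ ws) ≈ sum λ j → a j * D (B j ∷ ws)
  combination-head {n = zero}  alt a B ws = zero-head alt ws
  combination-head {n = suc n} alt a B ws = trans (additive alt _ _ ws)
    (+-cong (homogeneous alt _ _ ws) (combination-head alt (a ∘ suc) (B ∘ suc) ws))

  swap : ∀ {m k} {D : Form m (suc (suc k))} → Alternating D → ∀ u v ws → D (u ∷ v ∷ ws) ≈ - D (v ∷ u ∷ ws)
  swap {D = D} alt u v ws = inverseˡ-unique _ _ (begin
    D (u ∷ v ∷ ws) + D (v ∷ u ∷ ws)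
      ≈⟨ +-cong (+-identityˡ _) (+-identityʳ _) ⟨
    (0# + D (u ∷ v ∷ ws)) + (D (v ∷ u ∷ ws) + 0#)
      ≈⟨ +-cong (+-congʳ (vanishing alt u _ λ _ → refl)) (+-congˡ (vanishing alt v _ λ _ → refl)) ⟨
    (D (u ∷ u ∷ ws) + D (u ∷ v ∷ ws)) + (D (v ∷ u ∷ ws) + D (v ∷ v ∷ ws))
      ≈⟨ +-cong (additive (fixed alt u) u v ws) (additive (fixed alt v) u v ws) ⟨
    D (u ∷ u +ᵥ v ∷ ws) + D (v ∷ u +ᵥ v ∷ ws)
      ≈⟨ additive alt u v _ ⟨
    D (u +ᵥ v ∷ u +ᵥ v ∷ ws)
      ≈⟨ vanishing alt (u +ᵥ v) _ (λ _ → refl) ⟩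
    0# ∎)

  absorb : ∀ {m k} {D : Form m (suc k)} → Alternating D → ∀ u {vs ws} →
           Pointwise (λ v w → ∃ λ a → v ≐ a *ᵥ u +ᵥ w) vs ws → D (u ∷ vs) ≈ D (u ∷ ws)
  absorb alt u [] = refl
  absorb {D = D} alt u {v ∷ vs} {w ∷ ws} ((a , v≐) ∷ rest) = begin
    D (u ∷ v ∷ vs)                          ≈⟨ congruent alt ((λ _ → refl) ∷ v≐ ∷ Pointwise-≐-refl) ⟩
    D (u ∷ a *ᵥ u +ᵥ w ∷ vs)                ≈⟨ additive (fixed alt u) _ _ vs ⟩
    D (u ∷ a *ᵥ u ∷ vs) + D (u ∷ w ∷ vs)    ≈⟨ +-congʳ (homogeneous (fixed alt u) a u vs) ⟩
    a * D (u ∷ u ∷ vs) + D (u ∷ w ∷ vs)     ≈⟨ +-congʳ (*-congˡ (vanishing alt u _ λ _ → refl)) ⟩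
    a * 0# + D (u ∷ w ∷ vs)                 ≈⟨ trans (+-congʳ (zeroʳ a)) (+-identityˡ _) ⟩
    D (u ∷ w ∷ vs)                          ≈⟨ swap alt u w vs ⟩
    - D (w ∷ u ∷ vs)                        ≈⟨ -‿cong (absorb (fixed alt w) u rest) ⟩
    - D (w ∷ u ∷ ws)                        ≈⟨ swap alt u w ws ⟨
    D (u ∷ w ∷ ws)                          ∎

  move-to-front : ∀ {m k} {D : Form m (suc k)} → Alternating D → ∀ (B : Fin (suc k) → Vector Carrier m) j →
                  D (B j ∷ tabulate (B ∘ punchIn j)) ≈ sign j * D (tabulate B)
  move-to-front alt B zero = sym (*-identityˡ _)
  move-to-front {k = suc k} {D} alt B (suc j) = begin
    D (B (suc j) ∷ B zero ∷ tabulate (B ∘ suc ∘ punchIn j))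
      ≈⟨ swap alt _ _ _ ⟩
    - D (B zero ∷ B (suc j) ∷ tabulate (B ∘ suc ∘ punchIn j))
      ≈⟨ -‿cong (move-to-front (fixed alt (B zero)) (B ∘ suc) j) ⟩
    - (sign j * D (tabulate B))
      ≈⟨ solve 2 (λ s d → :- (s :* d) := (:- con (+ 1) :* s) :* d) refl _ _ ⟩
    sign (suc j) * D (tabulate B) ∎

  -- Expanding the first combination puts some `B j` in front; all multiples of `B j` in the other
  -- arguments can then be absorbed, which leaves combinations of the remaining vectors with column
  -- `j` deleted from the coefficients. The induction hypothesis thus yields exactly the first-row
  -- expansion of `det A`. It is applied to `D` with its first argument fixed, which is no
  -- determinant any more; hence the statement for arbitrary forms and arbitrary `m`.
  Alternating-combinations : ∀ {m k} {D : Form m k} → Alternating D → ∀ A (B : Fin k → Vector Carrier m) →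
    D (Vec.map (λ a → combination a B) A) ≈ det A * D (tabulate B)
  Alternating-combinations alt [] B = sym (*-identityˡ _)
  Alternating-combinations {D = D} alt (a ∷ as) B = begin
    D (combination a B ∷ Vec.map (λ b → combination b B) as)
      ≈⟨ combination-head alt a B _ ⟩
    sum (λ j → a j * D (B j ∷ Vec.map (λ b → combination b B) as))
      ≈⟨ sum-cong (λ j → *-congˡ {a j} (expand j)) ⟩
    sum (λ j → a j * (minor j * (sign j * D (tabulate B))))
      ≈⟨ sum-cong (λ j → solve 4 (λ a m s d → a :* (m :* (s :* d)) := d :* (s :* a :* m)) refl (a j) (minor j) (sign j) (D (tabulate B))) ⟩
    sum (λ j → D (tabulate B) * (sign j * a j * minor j))
      ≈⟨ *-sum (D (tabulate B)) (λ j → sign j * a j * minor j) ⟨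
    D (tabulate B) * sum (λ j → sign j * a j * minor j)
      ≈⟨ *-comm _ _ ⟩
    sum (λ j → sign j * a j * minor j) * D (tabulate B)
      ≈⟨ *-congʳ (det-∷ a as) ⟨
    det (a ∷ as) * D (tabulate B) ∎
    where
    minor : ∀ j → Carrier
    minor j = det (Vec.map (_∘ punchIn j) as)

    split : ∀ j {l} (bs : Vec _ l) → Pointwise (λ v w → ∃ λ b → v ≐ b *ᵥ B j +ᵥ w)
      (Vec.map (λ b → combination b B) bs)
      (Vec.map (λ b → combination b (B ∘ punchIn j)) (Vec.map (_∘ punchIn j) bs))
    split j []       = []
    split j (b ∷ bs) = (b j , λ i → sum-remove j (λ j′ → b j′ * B j′ i)) ∷ split j bs

    expand : ∀ j → D (B j ∷ Vec.map (λ b → combination b B) as) ≈ minor j * (sign j * D (tabulate B))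
    expand j = begin
      D (B j ∷ Vec.map (λ b → combination b B) as)
        ≈⟨ absorb alt (B j) (split j as) ⟩
      D (B j ∷ Vec.map (λ b → combination b (B ∘ punchIn j)) (Vec.map (_∘ punchIn j) as))
        ≈⟨ Alternating-combinations (fixed alt (B j)) (Vec.map (_∘ punchIn j) as) (B ∘ punchIn j) ⟩
      minor j * D (B j ∷ tabulate (B ∘ punchIn j))
        ≈⟨ *-congˡ (move-to-front alt B j) ⟩
      minor j * (sign j * D (tabulate B)) ∎

  det-tabulate : ∀ {k} (M : Fin k → Fin k → Carrier) → det (tabulate M) ≈ determinant M
  det-tabulate M = determinant-cong λ i j → reflexive (≡.cong (λ v → v j) (Vec.lookup∘tabulate M i))

  determinant-* : ∀ {k} (A B : Fin k → Fin k → Carrier) →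
                  determinant (λ i → combination (A i) B) ≈ determinant A * determinant B
  determinant-* A B = begin
    determinant (λ i → combination (A i) B)
      ≈⟨ determinant-cong (λ i j → reflexive (≡.cong (λ v → v j)
           (≡.trans (Vec.lookup-map i (λ a → combination a B) (tabulate A)) (≡.cong (λ a → combination a B) (Vec.lookup∘tabulate A i))))) ⟨
    det (Vec.map (λ a → combination a B) (tabulate A))
      ≈⟨ Alternating-combinations det-Alternating (tabulate A) B ⟩
    det (tabulate A) * det (tabulate B)
      ≈⟨ *-cong (det-tabulate A) (det-tabulate B) ⟩
    determinant A * determinant B ∎

-- Tridiagonal matrices with modified corners.

module Tridiagonal {c ℓ} (F : Field c ℓ) where
  open Field F hiding (zero)
  open Over F
  open Determinants F
  open RawSemiringDefinitions rawSemiring using (_^_; sum)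
  open IntegerCoefficients commutativeRing using (solve; _:=_; _:+_; _:*_; _:-_; :-_; con)
  open import Relation.Binary.Reasoning.Setoid setoid

  tridiagonal : (a p q : Carrier) → ∀ k → Fin k → Fin k → Carrier
  tridiagonal a p q (suc (suc k)) (suc i)       (suc j)       = tridiagonal a 0# q (suc k) i j
  tridiagonal a p q (suc zero)    zero          zero          = a + p + q
  tridiagonal a p q (suc (suc k)) zero          zero          = a + p
  tridiagonal a p q (suc (suc k)) zero          (suc zero)    = 1#
  tridiagonal a p q (suc (suc k)) zero          (suc (suc j)) = 0#
  tridiagonal a p q (suc (suc k)) (suc zero)    zero          = 1#
  tridiagonal a p q (suc (suc k)) (suc (suc i)) zero          = 0#

  left : ∀ {k} → Carrier → (ℕ → Carrier) → Fin k → Carrier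
  left p m zero    = p * m 1
  left p m (suc j) = m (suc (toℕ j))

  -- The matrix acts as the operator taking `m` at j to m(j - 1) + a m(j) + m(j + 1), with the
  -- corners `p` and `q` standing in for the neighbours that fall outside. The left neighbour is
  -- written `p * m 1` instead of assuming a value of `m 0`: the induction drops the first entry and
  -- continues with `p = 0#`, where the analogous assumption would fail in general.
  sum-tridiagonal : ∀ k a p q (m : ℕ → Carrier) → m (suc k) ≈ q * m k → (j : Fin k) →
    sum (λ i → m (suc (toℕ i)) * tridiagonal a p q k i j)
      ≈ left p m j + a * m (suc (toℕ j)) + m (suc (suc (toℕ j)))
  sum-tridiagonal (suc zero) a p q m h zero = trans
    (solve 4 (λ m a p q → m :* (a :+ p :+ q) :+ con (+ 0) := p :* m :+ a :* m :+ q :* m) refl (m 1) a p q)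
    (+-congˡ (sym h))
  sum-tridiagonal (suc (suc k)) a p q m h zero = trans
    (+-congˡ (+-congˡ (sum-zero {k} λ i → zeroʳ (m (3 ℕ.+ toℕ i)))))
    (solve 4 (λ m m′ a p → m :* (a :+ p) :+ (m′ :* con (+ 1) :+ con (+ 0)) := p :* m :+ a :* m :+ m′)
      refl (m 1) (m 2) a p)
  sum-tridiagonal (suc (suc k)) a p q m h (suc zero) = trans
    (+-congˡ (sum-tridiagonal (suc k) a 0# q (m ∘ suc) h zero))
    (solve 4 (λ m m′ m″ a → m :* con (+ 1) :+ (con (+ 0) :* m′ :+ a :* m′ :+ m″) := m :+ a :* m′ :+ m″)
      refl (m 1) (m 2) (m 3) a)
  sum-tridiagonal (suc (suc k)) a p q m h (suc (suc j)) = trans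
    (+-cong (zeroʳ (m 1)) (sum-tridiagonal (suc k) a 0# q (m ∘ suc) h (suc j)))
    (+-identityˡ _)

  determinant-zero-column : ∀ {k} (M : Fin (suc k) → Fin (suc k) → Carrier) → (∀ i → M i zero ≈ 0#) →
                            determinant M ≈ 0#
  determinant-zero-column {k} M M≈0 = sum-zero (vanish k M M≈0)
    where
    vanish : ∀ k (M : Fin (suc k) → Fin (suc k) → Carrier) → (∀ i → M i zero ≈ 0#) → ∀ j →
             sign j * M zero j * determinant (λ i j′ → M (suc i) (punchIn j j′)) ≈ 0#
    vanish k       M M≈0 zero    = trans (*-congʳ (trans (*-congˡ (M≈0 zero)) (zeroʳ _))) (zeroˡ _)
    vanish (suc k) M M≈0 (suc j) = trans
      (*-congˡ (determinant-zero-column (λ i j′ → M (suc i) (punchIn (suc j) j′)) (M≈0 ∘ suc)))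
      (zeroʳ _)

  determinant-tridiagonal : ∀ k a p q →
    determinant (tridiagonal a p q (2 ℕ.+ k))
      ≈ (a + p) * determinant (tridiagonal a 0# q (1 ℕ.+ k)) - determinant (tridiagonal a 0# q k)
  determinant-tridiagonal k a p q = begin
    1# * (a + p) * d₁ + ((- 1# * 1#) * 1# * determinant N + sum (λ j → sign (suc (suc j)) * 0# * minor j))
      ≈⟨ +-congˡ (+-cong (*-congˡ N≈d₀) (sum-zero {f = λ j → sign (suc (suc j)) * 0# * minor j} λ j → trans (*-congʳ (zeroʳ _)) (zeroˡ _))) ⟩
    1# * (a + p) * d₁ + ((- 1# * 1#) * 1# * d₀ + 0#)
      ≈⟨ solve 4 (λ a p d₁ d₀ → con (+ 1) :* (a :+ p) :* d₁ :+ ((:- con (+ 1) :* con (+ 1)) :* con (+ 1) :* d₀ :+ con (+ 0))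
                   := (a :+ p) :* d₁ :- d₀) refl a p d₁ d₀ ⟩
    (a + p) * d₁ - d₀ ∎
    where
    M : Fin (2 ℕ.+ k) → Fin (2 ℕ.+ k) → Carrier
    M = tridiagonal a p q (2 ℕ.+ k)
    N : Fin (1 ℕ.+ k) → Fin (1 ℕ.+ k) → Carrier
    N i j = M (suc i) (punchIn (suc zero) j)
    d₀ d₁ : Carrier
    d₀ = determinant (tridiagonal a 0# q k)
    d₁ = determinant (tridiagonal a 0# q (1 ℕ.+ k))
    minor : Fin k → Carrier
    minor j = determinant (λ i j′ → M (suc i) (punchIn (suc (suc j)) j′))

    corner : ∀ k (i j : Fin k) → tridiagonal a 0# q (suc k) (suc i) (suc j) ≈ tridiagonal a 0# q k i j
    corner (suc k) i j = refl

    -- The first column of `N` is a unit vector, but its first row can have a second nonzero entry.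
    -- In the expansion along that row the further terms vanish through their minors, which keep a
    -- zero column.
    vanish : ∀ k (N : Fin (suc k) → Fin (suc k) → Carrier) → (∀ i → N (suc i) zero ≈ 0#) → ∀ j →
             sign (suc j) * N zero (suc j) * determinant (λ i j′ → N (suc i) (punchIn (suc j) j′)) ≈ 0#
    vanish (suc k) N N≈0 j = trans
      (*-congˡ (determinant-zero-column (λ i j′ → N (suc i) (punchIn (suc j) j′)) N≈0))
      (zeroʳ _)

    N≈d₀ : determinant N ≈ d₀
    N≈d₀ = begin
      1# * 1# * determinant (λ i j → N (suc i) (suc j)) + sum {k} _
        ≈⟨ +-cong (*-congˡ (determinant-cong (corner k))) (sum-zero (vanish k N λ _ → refl)) ⟩
      1# * 1# * d₀ + 0#
        ≈⟨ trans (+-identityʳ _) (trans (*-congʳ (*-identityˡ 1#)) (*-identityˡ _)) ⟩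
      d₀ ∎

  -- As `x * y ≈ 1#`, both `x` and `y` are roots of the characteristic polynomial of the recurrence,
  -- so every combination of their powers solves it, and `y ^ k - x ^ suc k` has the right initial
  -- values. The factor `1# - x` stays on the left because it is not known here to be invertible.
  recurrence-solution : ∀ {x y} → x * y ≈ 1# → (f : ℕ → Carrier) → f 0 ≈ 1# → f 1 ≈ (x + y) + 1# →
    (∀ k → f (2 ℕ.+ k) ≈ (x + y) * f (1 ℕ.+ k) - f k) → ∀ k → (1# - x) * f k ≈ y ^ k - x ^ suc k
  recurrence-solution {x} {y} xy≈1 f f₀ f₁ rec = λ k → proj₁ (both k)
    where
    step : ∀ {a b} k → (1# - x) * a ≈ y ^ k - x ^ suc k → (1# - x) * b ≈ y ^ suc k - x ^ suc (suc k) →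
           (1# - x) * ((x + y) * b - a) ≈ y ^ suc (suc k) - x ^ suc (suc (suc k))
    step {a} {b} k ha hb = begin
      (1# - x) * ((x + y) * b - a)
        ≈⟨ solve 4 (λ x y a b → (con (+ 1) :- x) :* ((x :+ y) :* b :- a)
                     := (x :+ y) :* ((con (+ 1) :- x) :* b) :- (con (+ 1) :- x) :* a) refl x y a b ⟩
      (x + y) * ((1# - x) * b) - (1# - x) * a
        ≈⟨ +-cong (*-congˡ hb) (-‿cong ha) ⟩
      (x + y) * (y * y ^ k - x * x ^ suc k) - (y ^ k - x ^ suc k)
        ≈⟨ solve 4 (λ x y Y X → (x :+ y) :* (y :* Y :- x :* X) :- (Y :- X)
                     := (y :* (y :* Y) :- x :* (x :* X)) :+ (x :* y :- con (+ 1)) :* (Y :- X))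
             refl x y (y ^ k) (x ^ suc k) ⟩
      (y ^ suc (suc k) - x ^ suc (suc (suc k))) + (x * y - 1#) * (y ^ k - x ^ suc k)
        ≈⟨ +-congˡ (trans (*-congʳ (trans (+-congʳ xy≈1) (-‿inverseʳ 1#))) (zeroˡ _)) ⟩
      (y ^ suc (suc k) - x ^ suc (suc (suc k))) + 0#
        ≈⟨ +-identityʳ _ ⟩
      y ^ suc (suc k) - x ^ suc (suc (suc k)) ∎

    both : ∀ k → ((1# - x) * f k ≈ y ^ k - x ^ suc k) × ((1# - x) * f (suc k) ≈ y ^ suc k - x ^ suc (suc k))
    both zero    =
      trans (*-congˡ f₀) (solve 1 (λ x → (con (+ 1) :- x) :* con (+ 1) := con (+ 1) :- x :* con (+ 1)) refl x) ,
      (begin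
        (1# - x) * f 1               ≈⟨ *-congˡ f₁ ⟩
        (1# - x) * ((x + y) + 1#)    ≈⟨ solve 2 (λ x y → (con (+ 1) :- x) :* ((x :+ y) :+ con (+ 1))
                                          := (con (+ 1) :- x :* y) :+ (y :* con (+ 1) :- x :* (x :* con (+ 1)))) refl x y ⟩
        (1# - x * y) + (y ^ 1 - x ^ 2)  ≈⟨ +-congʳ (trans (+-congˡ (-‿cong xy≈1)) (-‿inverseʳ 1#)) ⟩
        0# + (y ^ 1 - x ^ 2)            ≈⟨ +-identityˡ _ ⟩
        y ^ 1 - x ^ 2 ∎)
    both (suc k) with both k
    ... | h₀ , h₁ = h₁ , trans (*-congˡ (rec k)) (step k h₀ h₁)

  determinant₁ : ∀ a p q → determinant (tridiagonal a p q 1) ≈ a + p + q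
  determinant₁ = solve 3 (λ a p q → con (+ 1) :* (a :+ p :+ q) :* con (+ 1) :+ con (+ 0) := a :+ p :+ q) refl

  -- Expansion along the first row removes the corner `1#`, so the determinants `f` do not directly
  -- satisfy a recurrence among themselves. They are expressed through the determinants `U` without
  -- corners, the Chebyshev polynomials of the second kind in `a` / 2, as the sum of two consecutive
  -- ones. In `corner-last` the extra entry sits at the far end and survives the expansion, so the
  -- recurrence is immediate.
  corner-first : ∀ {x y} → x * y ≈ 1# → ∀ k →
    (1# - x) * determinant (tridiagonal (x + y) 1# 0# k) ≈ y ^ k - x ^ suc k
  corner-first {x} {y} xy≈1 = recurrence-solution xy≈1 f refl
    (trans (determinant₁ a 1# 0#) (+-identityʳ _)) rec
    where
    a : Carrier
    a = x + y
    f U : ℕ → Carrier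
    f k = determinant (tridiagonal a 1# 0# k)
    U k = determinant (tridiagonal a 0# 0# k)

    U₁ : U 1 ≈ a
    U₁ = trans (determinant₁ a 0# 0#) (trans (+-identityʳ _) (+-identityʳ _))

    U-rec : ∀ k → U (2 ℕ.+ k) ≈ a * U (1 ℕ.+ k) - U k
    U-rec k = trans (determinant-tridiagonal k a 0# 0#) (+-congʳ (*-congʳ (+-identityʳ a)))

    f≈U : ∀ k → f (suc k) ≈ U (suc k) + U k
    f≈U zero    = trans (determinant₁ a 1# 0#) (trans (+-identityʳ _) (+-congʳ (sym U₁)))
    f≈U (suc k) = begin
      f (2 ℕ.+ k)                                ≈⟨ determinant-tridiagonal k a 1# 0# ⟩
      (a + 1#) * U (1 ℕ.+ k) - U k               ≈⟨ solve 3 (λ a u v → (a :+ con (+ 1)) :* u :- v := a :* u :- v :+ u) refl a (U (1 ℕ.+ k)) (U k) ⟩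
      (a * U (1 ℕ.+ k) - U k) + U (1 ℕ.+ k)      ≈⟨ +-congʳ (U-rec k) ⟨
      U (2 ℕ.+ k) + U (1 ℕ.+ k)                  ∎

    rec : ∀ k → f (2 ℕ.+ k) ≈ a * f (1 ℕ.+ k) - f k
    -- `f≈U` starts at index 1, so the instance involving `f 0` is computed directly.
    rec zero    = begin
      f 2                                        ≈⟨ determinant-tridiagonal 0 a 1# 0# ⟩
      (a + 1#) * U 1 - 1#                        ≈⟨ +-congʳ (trans (*-congˡ U₁) (*-comm _ _)) ⟩
      a * (a + 1#) - 1#                          ≈⟨ +-congʳ (*-congˡ (trans (determinant₁ a 1# 0#) (+-identityʳ _))) ⟨
      a * f 1 - f 0                              ∎
    rec (suc k) = begin
      f (3 ℕ.+ k)                                ≈⟨ f≈U (2 ℕ.+ k) ⟩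
      U (3 ℕ.+ k) + U (2 ℕ.+ k)                  ≈⟨ +-cong (U-rec (1 ℕ.+ k)) (U-rec k) ⟩
      (a * U (2 ℕ.+ k) - U (1 ℕ.+ k)) + (a * U (1 ℕ.+ k) - U k)
        ≈⟨ solve 4 (λ a u v w → (a :* u :- v) :+ (a :* v :- w) := a :* (u :+ v) :- (v :+ w)) refl a (U (2 ℕ.+ k)) (U (1 ℕ.+ k)) (U k) ⟩
      a * (U (2 ℕ.+ k) + U (1 ℕ.+ k)) - (U (1 ℕ.+ k) + U k)
        ≈⟨ +-cong (*-congˡ (f≈U (1 ℕ.+ k))) (-‿cong (f≈U k)) ⟨
      a * f (2 ℕ.+ k) - f (1 ℕ.+ k)              ∎

  corner-last : ∀ {x y} → x * y ≈ 1# → ∀ k →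
    (1# - x) * determinant (tridiagonal (x + y) 0# 1# k) ≈ y ^ k - x ^ suc k
  corner-last {x} {y} xy≈1 = recurrence-solution xy≈1 (λ k → determinant (tridiagonal (x + y) 0# 1# k)) refl
    (trans (determinant₁ (x + y) 0# 1#) (+-congʳ (+-identityʳ _)))
    (λ k → trans (determinant-tridiagonal k (x + y) 0# 1#) (+-congʳ (*-congʳ (+-identityʳ _))))

-- Identities between indices.

module IntegerIdentities where
  open ℤ.+-*-Solver using (solve; _:=_; _:+_; _:*_; _:-_; :-_; con)

  2i-i≡i : ∀ i → + 2 ℤ.* i ℤ.- i ≡ i
  2i-i≡i = solve 1 (λ i → con (+ 2) :* i :- i := i) ≡.refl

  [1+n]+r : ∀ n r → + 1 ℤ.+ n ℤ.+ r ≡ n ℤ.+ (r ℤ.+ + 1)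
  [1+n]+r = solve 2 (λ n r → con (+ 1) :+ n :+ r := n :+ (r :+ con (+ 1))) ≡.refl

  [1+n]+r-1 : ∀ n r → + 1 ℤ.+ n ℤ.+ r ℤ.- + 1 ≡ n ℤ.+ r
  [1+n]+r-1 = solve 2 (λ n r → con (+ 1) :+ n :+ r :- con (+ 1) := n :+ r) ≡.refl

  [1+n]+r-2 : ∀ n r → + 1 ℤ.+ n ℤ.+ r ℤ.- + 1 ℤ.- + 1 ≡ n ℤ.+ (r ℤ.- + 1)
  [1+n]+r-2 = solve 2 (λ n r → con (+ 1) :+ n :+ r :- con (+ 1) :- con (+ 1) := n :+ (r :- con (+ 1))) ≡.refl

  -r+1 : ∀ r → ℤ.- r ℤ.+ + 1 ≡ ℤ.- (r ℤ.- + 1)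
  -r+1 = solve 1 (λ r → :- r :+ con (+ 1) := :- (r :- con (+ 1))) ≡.refl

  -r-1 : ∀ r → ℤ.- r ℤ.- + 1 ≡ ℤ.- (r ℤ.+ + 1)
  -r-1 = solve 1 (λ r → :- r :- con (+ 1) := :- (r :+ con (+ 1))) ≡.refl

  r-s+t : ∀ r s t → r ℤ.- s ℤ.+ t ≡ r ℤ.+ t ℤ.- s
  r-s+t = solve 3 (λ r s t → r :- s :+ t := r :+ t :- s) ≡.refl

  -r-Ky : ∀ r K y → ℤ.- r ℤ.- K ℤ.* y ≡ ℤ.- (r ℤ.- K ℤ.* (ℤ.- y))
  -r-Ky = solve 3 (λ r K y → :- r :- K :* y := :- (r :- K :* (:- y))) ≡.refl

  r+K-Ky : ∀ r K y → r ℤ.+ K ℤ.- K ℤ.* y ≡ r ℤ.- K ℤ.* ℤ.pred y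
  r+K-Ky = solve 3 (λ r K y → r :+ K :- K :* y := r :- K :* (con -[1+ 0 ] :+ y)) ≡.refl

  r≡r+s-s : ∀ r s → r ≡ r ℤ.+ s ℤ.- s
  r≡r+s-s = solve 2 (λ r s → r := r :+ s :- s) ≡.refl

  first-left : ∀ i → + 0 ℤ.- i ≡ ℤ.- (+ 1 ℤ.+ i ℤ.- + 1)
  first-left = solve 1 (λ i → con (+ 0) :- i := :- (con (+ 1) :+ i :- con (+ 1))) ≡.refl

  first-left′ : ∀ i → + 0 ℤ.+ i ℤ.- + 1 ≡ ℤ.- (+ 1 ℤ.- i)
  first-left′ = solve 1 (λ i → con (+ 0) :+ i :- con (+ 1) := :- (con (+ 1) :- i)) ≡.refl

  right : ∀ k i → + 1 ℤ.+ k ℤ.- i ≡ ℤ.- (k ℤ.+ i) ℤ.+ (+ 2 ℤ.* k ℤ.+ + 1)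
  right = solve 2 (λ k i → con (+ 1) :+ k :- i := :- (k :+ i) :+ (con (+ 2) :* k :+ con (+ 1))) ≡.refl

  first-right : ∀ k i → + 1 ℤ.+ k ℤ.+ i ℤ.- + 1 ≡ ℤ.- (ℤ.- (k ℤ.+ i))
  first-right = solve 2 (λ k i → con (+ 1) :+ k :+ i :- con (+ 1) := :- (:- (k :+ i))) ≡.refl

  last-left : ∀ i → + 0 ℤ.- i ≡ ℤ.- (+ 0 ℤ.+ i ℤ.- + 0)
  last-left = solve 1 (λ i → con (+ 0) :- i := :- (con (+ 0) :+ i :- con (+ 0))) ≡.refl

  j-i+1 : ∀ j i → + 1 ℤ.+ j ℤ.- i ≡ j ℤ.- i ℤ.+ + 1
  j-i+1 = solve 2 (λ j i → con (+ 1) :+ j :- i := j :- i :+ con (+ 1)) ≡.refl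

  1+j-i-1 : ∀ j i → j ℤ.- i ≡ + 1 ℤ.+ j ℤ.- i ℤ.- + 1
  1+j-i-1 = solve 2 (λ j i → j :- i := con (+ 1) :+ j :- i :- con (+ 1)) ≡.refl

  j+i-d+1 : ∀ j i d → + 1 ℤ.+ j ℤ.+ i ℤ.- d ≡ j ℤ.+ i ℤ.- d ℤ.+ + 1
  j+i-d+1 = solve 3 (λ j i d → con (+ 1) :+ j :+ i :- d := j :+ i :- d :+ con (+ 1)) ≡.refl

  1+j+i-d-1 : ∀ j i d → j ℤ.+ i ℤ.- d ≡ + 1 ℤ.+ j ℤ.+ i ℤ.- d ℤ.- + 1
  1+j+i-d-1 = solve 3 (λ j i d → j :+ i :- d := con (+ 1) :+ j :+ i :- d :- con (+ 1)) ≡.refl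

  last-right : ∀ k i → k ℤ.+ i ℤ.- + 0 ≡ ℤ.- (ℤ.- (k ℤ.+ i))
  last-right = solve 2 (λ k i → k :+ i :- con (+ 0) := :- (:- (k :+ i))) ≡.refl

  last-right′ : ∀ k i → + 1 ℤ.+ k ℤ.+ i ℤ.- + 0 ≡ ℤ.- (k ℤ.- i) ℤ.+ (+ 2 ℤ.* k ℤ.+ + 1)
  last-right′ = solve 2 (λ k i → con (+ 1) :+ k :+ i :- con (+ 0) := :- (k :- i) :+ (con (+ 2) :* k :+ con (+ 1))) ≡.refl

  n-i+j-Ky : ∀ n i j K y → n ℤ.- i ℤ.+ j ℤ.- K ℤ.* y ≡ n ℤ.+ (j ℤ.- i ℤ.- K ℤ.* y)
  n-i+j-Ky = solve 5 (λ n i j K y → n :- i :+ j :- K :* y := n :+ (j :- i :- K :* y)) ≡.refl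

  n+i+j-Ky-1 : ∀ n i j K y → n ℤ.+ i ℤ.+ j ℤ.- K ℤ.* y ℤ.- + 1 ≡ n ℤ.+ (j ℤ.+ i ℤ.- + 1 ℤ.- K ℤ.* y)
  n+i+j-Ky-1 = solve 5 (λ n i j K y → n :+ i :+ j :- K :* y :- con (+ 1) := n :+ (j :+ i :- con (+ 1) :- K :* y)) ≡.refl

  n+i+j-Ky : ∀ n i j K y → n ℤ.+ i ℤ.+ j ℤ.- K ℤ.* y ≡ n ℤ.+ (j ℤ.+ i ℤ.- + 0 ℤ.- K ℤ.* y)
  n+i+j-Ky = solve 5 (λ n i j K y → n :+ i :+ j :- K :* y := n :+ (j :+ i :- con (+ 0) :- K :* y)) ≡.refl

open IntegerIdentities

-- Sums over lists and symmetric intervals, and recurrences for elementary symmetric functions.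

module ListSums {c ℓ} (F : Field c ℓ) where
  open Field F hiding (zero)
  open Over F
  open IntegerCoefficients commutativeRing using (solve; _:=_; _:+_; _:*_; con)
  open import Relation.Binary.Reasoning.Setoid setoid

  module _ {a} {A : Set a} where

    ∑-cong : ∀ as {f g : A → Carrier} → (∀ i → f i ≈ g i) → ∑[ as ] f ≈ ∑[ as ] g
    ∑-cong []       eq = refl
    ∑-cong (i ∷ as) eq = +-cong (eq i) (∑-cong as eq)

    ∑-++ : ∀ as bs (f : A → Carrier) → ∑[ as ++ bs ] f ≈ ∑[ as ] f + ∑[ bs ] f
    ∑-++ []       bs f = sym (+-identityˡ _)
    ∑-++ (i ∷ as) bs f = trans (+-congˡ (∑-++ as bs f)) (sym (+-assoc _ _ _))

    ∑-+ : ∀ as (f g : A → Carrier) → ∑[ as ] (λ i → f i + g i) ≈ ∑[ as ] f + ∑[ as ] g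
    ∑-+ []       f g = sym (+-identityˡ _)
    ∑-+ (i ∷ as) f g = trans (+-congˡ (∑-+ as f g))
      (solve 4 (λ a b c d → (a :+ b) :+ (c :+ d) := (a :+ c) :+ (b :+ d)) refl (f i) (g i) _ _)

    *-∑ : ∀ as b (f : A → Carrier) → b * ∑[ as ] f ≈ ∑[ as ] (λ i → b * f i)
    *-∑ []       b f = zeroʳ b
    *-∑ (i ∷ as) b f = trans (distribˡ _ _ _) (+-congˡ (*-∑ as b f))

    ∑-map : ∀ {b} {B : Set b} (h : B → A) bs (f : A → Carrier) → ∑[ List.map h bs ] f ≡ ∑[ bs ] (f ∘ h)
    ∑-map h bs f = ≡.cong (List.foldr _+_ 0#) (≡.sym (List.map-∘ bs))

  ∑-applyUpTo : ∀ (f : ℕ → ℤ) m g → ∑[ applyUpTo f (suc m) ] g ≈ ∑[ applyUpTo f m ] g + g (f m)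
  ∑-applyUpTo f zero    g = +-comm _ _
  ∑-applyUpTo f (suc m) g = trans (+-congˡ (∑-applyUpTo (f ∘ suc) m g)) (sym (+-assoc _ _ _))

  interval≡applyUpTo : ∀ N → interval N ≡ applyUpTo (λ a → + a ℤ.- + N) (suc (2 ℕ.* N))
  interval≡applyUpTo N = List.map-upTo (λ a → + a ℤ.- + N) (suc (2 ℕ.* N))

  -- The list is a shifted `upTo`; seeing it grow at both ends at once is what makes induction on
  -- `N` compatible with the symmetry and the shift of the interval.
  ∑-interval-suc : ∀ N g → ∑[ interval (suc N) ] g ≈ g -[1+ N ] + ∑[ interval N ] g + g (+ suc N)
  ∑-interval-suc N g = begin
    ∑[ interval (suc N) ] g
      ≡⟨ ≡.cong (λ as → ∑[ as ] g) (≡.trans (interval≡applyUpTo (suc N)) (≡.cong (λ m → applyUpTo shift (suc m)) (ℕ.*-suc 2 N))) ⟩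
    g -[1+ N ] + ∑[ applyUpTo (shift ∘ suc) (suc (suc (2 ℕ.* N))) ] g
      ≈⟨ +-congˡ (∑-applyUpTo (shift ∘ suc) (suc (2 ℕ.* N)) g) ⟩
    g -[1+ N ] + (∑[ applyUpTo (shift ∘ suc) (suc (2 ℕ.* N)) ] g + g (shift (2 ℕ.+ 2 ℕ.* N)))
      ≈⟨ +-congˡ (+-cong inner (reflexive (≡.cong g last))) ⟩
    g -[1+ N ] + (∑[ interval N ] g + g (+ suc N))
      ≈⟨ +-assoc _ _ _ ⟨
    g -[1+ N ] + ∑[ interval N ] g + g (+ suc N) ∎
    where
    shift : ℕ → ℤ
    shift a = + a ℤ.- + suc N

    last : shift (2 ℕ.+ 2 ℕ.* N) ≡ + suc N
    last = ≡.trans (≡.cong (λ m → + m ℤ.- + suc N) (≡.sym (ℕ.*-suc 2 N)))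
      (≡.trans (≡.cong (ℤ._- + suc N) (ℤ.pos-* 2 (suc N)))
        (2i-i≡i (+ suc N)))

    inner : ∑[ applyUpTo (shift ∘ suc) (suc (2 ℕ.* N)) ] g ≈ ∑[ interval N ] g
    inner = begin
      ∑[ applyUpTo (shift ∘ suc) (suc (2 ℕ.* N)) ] g
        ≡⟨ ≡.cong (λ as → ∑[ as ] g) (List.map-upTo (shift ∘ suc) (suc (2 ℕ.* N))) ⟨
      ∑[ List.map (shift ∘ suc) (upTo (suc (2 ℕ.* N))) ] g
        ≡⟨ ≡.cong (λ as → ∑[ as ] g) (List.map-cong shift-suc (upTo (suc (2 ℕ.* N)))) ⟩
      ∑[ interval N ] g ∎
      where
      shift-suc : ∀ a → shift (suc a) ≡ + a ℤ.- + N
      shift-suc a = ≡.trans (ℤ.[1+m]⊖[1+n]≡m⊖n a N) (≡.sym (ℤ.m-n≡m⊖n a N))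

  ∑-interval-neg : ∀ N g → ∑[ interval N ] (g ∘ ℤ.-_) ≈ ∑[ interval N ] g
  ∑-interval-neg zero    g = refl
  ∑-interval-neg (suc N) g = begin
    ∑[ interval (suc N) ] (g ∘ ℤ.-_)                             ≈⟨ ∑-interval-suc N (g ∘ ℤ.-_) ⟩
    g (+ suc N) + ∑[ interval N ] (g ∘ ℤ.-_) + g -[1+ N ]        ≈⟨ +-congʳ (+-congˡ (∑-interval-neg N g)) ⟩
    g (+ suc N) + ∑[ interval N ] g + g -[1+ N ]
      ≈⟨ solve 3 (λ a b c → a :+ b :+ c := c :+ b :+ a) refl (g (+ suc N)) _ (g -[1+ N ]) ⟩
    g -[1+ N ] + ∑[ interval N ] g + g (+ suc N)                 ≈⟨ ∑-interval-suc N g ⟨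
    ∑[ interval (suc N) ] g                                      ∎

  -- Shifting the interval gains a value at one end and loses one at the other. Both are kept, since
  -- that they vanish is a matter of the application.
  ∑-interval-pred : ∀ N g →
    ∑[ interval N ] (g ∘ ℤ.pred) + g (+ N) ≈ ∑[ interval N ] g + g (ℤ.pred (ℤ.- + N))
  ∑-interval-pred zero    g =
    solve 2 (λ a b → a :+ con (+ 0) :+ b := b :+ con (+ 0) :+ a) refl (g -[1+ 0 ]) (g (+ 0))
  ∑-interval-pred (suc N) g = begin
    ∑[ interval (suc N) ] (g ∘ ℤ.pred) + g (+ suc N)
      ≈⟨ +-congʳ (∑-interval-suc N (g ∘ ℤ.pred)) ⟩
    g -[1+ suc N ] + ∑[ interval N ] (g ∘ ℤ.pred) + g (+ N) + g (+ suc N)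
      ≈⟨ +-congʳ (+-assoc _ _ _) ⟩
    g -[1+ suc N ] + (∑[ interval N ] (g ∘ ℤ.pred) + g (+ N)) + g (+ suc N)
      ≈⟨ +-congʳ (+-congˡ (trans (∑-interval-pred N g) (+-congˡ (reflexive (≡.cong g (pred-neg N)))))) ⟩
    g -[1+ suc N ] + (∑[ interval N ] g + g -[1+ N ]) + g (+ suc N)
      ≈⟨ solve 4 (λ a b c d → a :+ (b :+ c) :+ d := c :+ b :+ d :+ a) refl (g -[1+ suc N ]) _ (g -[1+ N ]) (g (+ suc N)) ⟩
    g -[1+ N ] + ∑[ interval N ] g + g (+ suc N) + g -[1+ suc N ]
      ≈⟨ +-congʳ (∑-interval-suc N g) ⟨
    ∑[ interval (suc N) ] g + g -[1+ suc N ] ∎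
    where
    pred-neg : ∀ N → ℤ.pred (ℤ.- + N) ≡ -[1+ N ]
    pred-neg zero    = ≡.refl
    pred-neg (suc N) = ≡.refl

  ∑-interval-centre : ∀ N g → (∀ m → g (+ suc m) ≈ 0#) → (∀ m → g -[1+ m ] ≈ 0#) →
                      ∑[ interval N ] g ≈ g (+ 0)
  ∑-interval-centre zero    g h₊ h₋ = +-identityʳ _
  ∑-interval-centre (suc N) g h₊ h₋ = begin
    ∑[ interval (suc N) ] g                          ≈⟨ ∑-interval-suc N g ⟩
    g -[1+ N ] + ∑[ interval N ] g + g (+ suc N)     ≈⟨ +-cong (+-cong (h₋ N) (∑-interval-centre N g h₊ h₋)) (h₊ N) ⟩
    0# + g (+ 0) + 0#                                ≈⟨ trans (+-identityʳ _) (+-identityˡ _) ⟩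
    g (+ 0)                                          ∎

  private
    prod : List Carrier → Carrier
    prod = List.foldr _*_ 1#

    select : ℕ → List (List Carrier) → List (List Carrier)
    select r = filter (λ s → length s ℕ.≟ r)

    ∑-select-zero : ∀ z ss → ∑[ select 0 (List.map (z ∷_) ss) ] prod ≈ 0#
    ∑-select-zero z []       = refl
    ∑-select-zero z (s ∷ ss) = ∑-select-zero z ss

    ∑-select-suc : ∀ r z ss → ∑[ select (suc r) (List.map (z ∷_) ss) ] prod ≈ z * ∑[ select r ss ] prod
    ∑-select-suc r z []       = sym (zeroʳ z)
    ∑-select-suc r z (s ∷ ss) with does (length s ℕ.≟ r)
    ... | false = ∑-select-suc r z ss
    ... | true  = trans (+-congˡ (∑-select-suc r z ss)) (sym (distribˡ _ _ _))

    e-split : ∀ r z zs → e r (z ∷ zs) ≈ e r zs + ∑[ select r (List.map (z ∷_) (sublists zs)) ] prod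
    e-split r z zs = trans
      (reflexive (≡.cong (λ ss → ∑[ ss ] prod) (List.filter-++ (λ s → length s ℕ.≟ r) (sublists zs) _)))
      (∑-++ (select r (sublists zs)) _ prod)

  e-∷-zero : ∀ z zs → e 0 (z ∷ zs) ≈ e 0 zs
  e-∷-zero z zs = trans (e-split 0 z zs) (trans (+-congˡ (∑-select-zero z (sublists zs))) (+-identityʳ _))

  e-∷-suc : ∀ r z zs → e (suc r) (z ∷ zs) ≈ e (suc r) zs + z * e r zs
  e-∷-suc r z zs = trans (e-split (suc r) z zs) (+-congˡ (∑-select-suc r z (sublists zs)))

  -- On lists, letters can be adjoined one at a time, whereas `ė` only grows by pairs. The value 0
  -- at negative indices makes the recurrence `eℤ-∷` hold at every integer.
  eℤ : ℤ → List Carrier → Carrier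
  eℤ (+ r)    zs = e r zs
  eℤ -[1+ r ] zs = 0#

  eℤ-∷ : ∀ r z zs → eℤ r (z ∷ zs) ≈ eℤ r zs + z * eℤ (r ℤ.- + 1) zs
  eℤ-∷ (+ zero)  z zs = trans (e-∷-zero z zs) (sym (trans (+-congˡ (zeroʳ z)) (+-identityʳ _)))
  eℤ-∷ (+ suc r) z zs = e-∷-suc r z zs
  eℤ-∷ -[1+ r ]  z zs = sym (trans (+-identityˡ _) (zeroʳ z))

  -- The generating function acquires the factor (1 + xT)(1 + yT) = 1 + (x + y)T + T^2.
  eℤ-∷∷ : ∀ r {x y} zs → x * y ≈ 1# →
    eℤ r (x ∷ y ∷ zs) ≈ eℤ r zs + (x + y) * eℤ (r ℤ.- + 1) zs + eℤ (r ℤ.- + 1 ℤ.- + 1) zs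
  eℤ-∷∷ r {x} {y} zs xy≈1 = begin
    eℤ r (x ∷ y ∷ zs)
      ≈⟨ eℤ-∷ r x (y ∷ zs) ⟩
    eℤ r (y ∷ zs) + x * eℤ (r ℤ.- + 1) (y ∷ zs)
      ≈⟨ +-cong (eℤ-∷ r y zs) (*-congˡ (eℤ-∷ (r ℤ.- + 1) y zs)) ⟩
    (a + y * b) + x * (b + y * d)
      ≈⟨ solve 5 (λ x y a b d → (a :+ y :* b) :+ x :* (b :+ y :* d) := a :+ (x :+ y) :* b :+ (x :* y) :* d) refl x y a b d ⟩
    a + (x + y) * b + (x * y) * d
      ≈⟨ +-congˡ (trans (*-congʳ xy≈1) (*-identityˡ d)) ⟩
    a + (x + y) * b + d ∎
    where
    a b d : Carrier
    a = eℤ r zs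
    b = eℤ (r ℤ.- + 1) zs
    d = eℤ (r ℤ.- + 1 ℤ.- + 1) zs

  ė≈eℤ : ∀ {n} (x : Vector Carrier n) r → ė x r ≈ eℤ r (List.concatMap (λ i → x i ∷ x i ⁻¹ ∷ []) (allFin n))
  ė≈eℤ x (+ r)    = refl
  ė≈eℤ x -[1+ r ] = refl

  ė-suc : ∀ {n} (x : Vector Carrier (suc n)) r → x zero * x zero ⁻¹ ≈ 1# →
    ė x r ≈ ė (x ∘ suc) r + (x zero + x zero ⁻¹) * ė (x ∘ suc) (r ℤ.- + 1) + ė (x ∘ suc) (r ℤ.- + 1 ℤ.- + 1)
  ė-suc {n} x r xx⁻¹≈1 = begin
    ė x r
      ≈⟨ ė≈eℤ x r ⟩
    eℤ r (x zero ∷ x zero ⁻¹ ∷ List.concatMap pair (List.tabulate suc))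
      ≡⟨ ≡.cong (λ zs → eℤ r (x zero ∷ x zero ⁻¹ ∷ zs)) letters ⟩
    eℤ r (x zero ∷ x zero ⁻¹ ∷ zs)
      ≈⟨ eℤ-∷∷ r zs xx⁻¹≈1 ⟩
    eℤ r zs + (x zero + x zero ⁻¹) * eℤ (r ℤ.- + 1) zs + eℤ (r ℤ.- + 1 ℤ.- + 1) zs
      ≈⟨ +-cong (+-cong (ė≈eℤ (x ∘ suc) r) (*-congˡ (ė≈eℤ (x ∘ suc) (r ℤ.- + 1)))) (ė≈eℤ (x ∘ suc) (r ℤ.- + 1 ℤ.- + 1)) ⟨
    ė (x ∘ suc) r + (x zero + x zero ⁻¹) * ė (x ∘ suc) (r ℤ.- + 1) + ė (x ∘ suc) (r ℤ.- + 1 ℤ.- + 1) ∎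
    where
    pair : Fin (suc n) → List Carrier
    pair i = x i ∷ x i ⁻¹ ∷ []

    zs : List Carrier
    zs = List.concatMap (pair ∘ suc) (allFin n)

    letters : List.concatMap pair (List.tabulate suc) ≡ zs
    letters = ≡.trans (≡.cong (List.concatMap pair) (≡.sym (List.map-tabulate id suc)))
      (List.concatMap-map pair suc (allFin n))

-- Periodised elementary symmetric functions and the determinants built from them.

∣i+j∣-large : ∀ {n} i j → n ℕ.+ ∣ j ∣ < ∣ i ∣ → n < ∣ i ℤ.+ j ∣
∣i+j∣-large {n} i j h = ℕ.+-cancelʳ-< _ _ _ (ℕ.<-≤-trans h
  (ℕ.≤-trans (ℕ.≤-reflexive (≡.cong ∣_∣ (r≡r+s-s i j))) (ℤ.∣i-j∣≤∣i∣+∣j∣ (i ℤ.+ j) j)))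

∣r-Ky∣-large : ∀ {n} K r y → n ℕ.+ ∣ r ∣ < K ℕ.* ∣ y ∣ → n < ∣ r ℤ.- + K ℤ.* y ∣
∣r-Ky∣-large {n} K r y h = ≡.subst (n <_) (≡.cong ∣_∣ (ℤ.+-comm (ℤ.- (+ K ℤ.* y)) r))
  (∣i+j∣-large (ℤ.- (+ K ℤ.* y)) r
    (≡.subst (n ℕ.+ ∣ r ∣ <_) (≡.sym (≡.trans (ℤ.∣-i∣≡∣i∣ (+ K ℤ.* y)) (ℤ.abs-* (+ K) y))) h))

-- The corner of the tridiagonal matrices that carries the extra 1.
data Corner : Set where
  first last : Corner

offset : Corner → ℤ
offset first = + 1
offset last  = + 0

module Periodisation {c ℓ} (F : Field c ℓ) where
  open Field F hiding (zero)
  open Over F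
  open Determinants F
  open Tridiagonal F
  open ListSums F
  open RawSemiringDefinitions rawSemiring using (_^_; sum; product)
  open IntegerCoefficients commutativeRing using (solve; _:=_; _:+_; _:*_; _:-_; :-_; con)
  open import Relation.Binary.Reasoning.Setoid setoid

  Invertible : ∀ {n} → Vector Carrier n → Set ℓ
  Invertible x = ∀ i → x i * x i ⁻¹ ≈ 1#

  centred : ∀ {n} → Vector Carrier n → ℤ → Carrier
  centred {n} x r = ė x (+ n ℤ.+ r)

  centred-suc : ∀ {n} (x : Vector Carrier (suc n)) → Invertible x → ∀ r →
    centred x r ≈ centred (x ∘ suc) (r ℤ.+ + 1) + (x zero + x zero ⁻¹) * centred (x ∘ suc) r
                  + centred (x ∘ suc) (r ℤ.- + 1)
  centred-suc {n} x inv r = trans (ė-suc x (+ suc n ℤ.+ r) (inv zero))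
    (+-cong (+-cong (ė-≡ ([1+n]+r (+ n) r)) (*-congˡ (ė-≡ ([1+n]+r-1 (+ n) r)))) (ė-≡ ([1+n]+r-2 (+ n) r)))
    where
    ė-≡ : ∀ {s t} → s ≡ t → ė (x ∘ suc) s ≈ ė (x ∘ suc) t
    ė-≡ s≡t = reflexive (≡.cong (ė (x ∘ suc)) s≡t)

  -- The recurrence `centred-suc` treats r + 1 and r - 1 alike, so evenness is inherited from the
  -- case without variables, where `centred` is the indicator of 0. By the same recurrence the
  -- support grows by one on each side per variable.
  centred-neg : ∀ {n} (x : Vector Carrier n) → Invertible x → ∀ r → centred x (ℤ.- r) ≈ centred x r
  centred-neg {zero}  x inv (+ zero)   = refl
  centred-neg {zero}  x inv (+ suc r)  = refl
  centred-neg {zero}  x inv (-[1+ r ]) = refl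
  centred-neg {suc n} x inv r = begin
    centred x (ℤ.- r)
      ≈⟨ centred-suc x inv (ℤ.- r) ⟩
    a (ℤ.- r ℤ.+ + 1) + X * a (ℤ.- r) + a (ℤ.- r ℤ.- + 1)
      ≡⟨ ≡.cong₂ (λ s t → a s + X * a (ℤ.- r) + a t) (-r+1 r) (-r-1 r) ⟩
    a (ℤ.- (r ℤ.- + 1)) + X * a (ℤ.- r) + a (ℤ.- (r ℤ.+ + 1))
      ≈⟨ +-cong (+-cong (neg (r ℤ.- + 1)) (*-congˡ (neg r))) (neg (r ℤ.+ + 1)) ⟩
    a (r ℤ.- + 1) + X * a r + a (r ℤ.+ + 1)
      ≈⟨ solve 3 (λ a b c → a :+ b :+ c := c :+ b :+ a) refl _ _ _ ⟩
    a (r ℤ.+ + 1) + X * a r + a (r ℤ.- + 1)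
      ≈⟨ centred-suc x inv r ⟨
    centred x r ∎
    where
    X : Carrier
    X = x zero + x zero ⁻¹
    a : ℤ → Carrier
    a = centred (x ∘ suc)
    neg : ∀ r → a (ℤ.- r) ≈ a r
    neg = centred-neg (x ∘ suc) (inv ∘ suc)

  centred-support : ∀ {n} (x : Vector Carrier n) → Invertible x → ∀ r → n < ∣ r ∣ → centred x r ≈ 0#
  centred-support {zero}  x inv (+ suc r) _  = refl
  centred-support {zero}  x inv -[1+ r ]  _  = refl
  centred-support {suc n} x inv r n<r = begin
    centred x r
      ≈⟨ centred-suc x inv r ⟩
    a (r ℤ.+ + 1) + X * a r + a (r ℤ.- + 1)
      ≈⟨ +-cong (+-cong (vanish (r ℤ.+ + 1) (∣i+j∣-large r (+ 1) h)) (*-congˡ (vanish r (ℕ.<-trans (ℕ.n<1+n n) n<r))))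
           (vanish (r ℤ.- + 1) (∣i+j∣-large r (ℤ.- + 1) h)) ⟩
    0# + X * 0# + 0#
      ≈⟨ solve 1 (λ x → con (+ 0) :+ x :* con (+ 0) :+ con (+ 0) := con (+ 0)) refl X ⟩
    0# ∎
    where
    X : Carrier
    X = x zero + x zero ⁻¹
    a : ℤ → Carrier
    a = centred (x ∘ suc)
    vanish : ∀ r → n < ∣ r ∣ → a r ≈ 0#
    vanish = centred-support (x ∘ suc) (inv ∘ suc)
    h : n ℕ.+ 1 < ∣ r ∣
    h = ≡.subst (_< ∣ r ∣) (ℕ.+-comm 1 n) n<r

  parity : ℤ → Carrier
  parity y = (- 1#) ^ ∣ y ∣

  parity-pred : ∀ y → parity y ≈ - parity (ℤ.pred y)
  parity-pred (+ zero)  = solve 0 (con (+ 1) := :- (:- con (+ 1) :* con (+ 1))) refl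
  parity-pred (+ suc m) = solve 1 (λ s → :- con (+ 1) :* s := :- s) refl (parity (+ m))
  parity-pred -[1+ m ]  = solve 1 (λ s → s := :- (:- con (+ 1) :* s)) refl (parity -[1+ m ])

  -- The N-th partial sum of ∑_y (-1)^y ė_{n+r-Ky}.
  periodised : ℕ → ℕ → ∀ {n} → Vector Carrier n → ℤ → Carrier
  periodised N K x r = ∑[ interval N ] λ y → parity y * centred x (r ℤ.- + K ℤ.* y)

  module _ (N K : ℕ) where

    periodised-suc : ∀ {n} (x : Vector Carrier (suc n)) → Invertible x → ∀ r →
      periodised N K x r ≈ periodised N K (x ∘ suc) (r ℤ.+ + 1)
        + (x zero + x zero ⁻¹) * periodised N K (x ∘ suc) r + periodised N K (x ∘ suc) (r ℤ.- + 1)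
    periodised-suc x inv r = begin
      ∑[ Y ] (λ y → parity y * centred x (r ℤ.- + K ℤ.* y))
        ≈⟨ ∑-cong Y expand ⟩
      ∑[ Y ] (λ y → t (r ℤ.+ + 1) y + X * t r y + t (r ℤ.- + 1) y)
        ≈⟨ ∑-+ Y (λ y → t (r ℤ.+ + 1) y + X * t r y) (t (r ℤ.- + 1)) ⟩
      ∑[ Y ] (λ y → t (r ℤ.+ + 1) y + X * t r y) + b (r ℤ.- + 1)
        ≈⟨ +-congʳ (trans (∑-+ Y (t (r ℤ.+ + 1)) (λ y → X * t r y)) (+-congˡ (sym (*-∑ Y X (t r))))) ⟩
      b (r ℤ.+ + 1) + X * b r + b (r ℤ.- + 1) ∎
      where
      X : Carrier
      X = x zero + x zero ⁻¹
      Y = interval N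
      b : ℤ → Carrier
      b = periodised N K (x ∘ suc)
      t : ℤ → ℤ → Carrier
      t r y = parity y * centred (x ∘ suc) (r ℤ.- + K ℤ.* y)
      expand : ∀ y → parity y * centred x (r ℤ.- + K ℤ.* y) ≈ t (r ℤ.+ + 1) y + X * t r y + t (r ℤ.- + 1) y
      expand y = begin
        parity y * centred x s
          ≈⟨ *-congˡ (centred-suc x inv s) ⟩
        parity y * (centred (x ∘ suc) (s ℤ.+ + 1) + X * centred (x ∘ suc) s + centred (x ∘ suc) (s ℤ.- + 1))
          ≡⟨ ≡.cong₂ (λ p q → parity y * (centred (x ∘ suc) p + X * centred (x ∘ suc) s + centred (x ∘ suc) q))
               (r-s+t r (+ K ℤ.* y) (+ 1)) (r-s+t r (+ K ℤ.* y) (ℤ.- + 1)) ⟩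
        parity y * (centred (x ∘ suc) (r ℤ.+ + 1 ℤ.- + K ℤ.* y) + X * centred (x ∘ suc) s
          + centred (x ∘ suc) (r ℤ.- + 1 ℤ.- + K ℤ.* y))
          ≈⟨ solve 5 (λ p a X b c → p :* (a :+ X :* b :+ c) := p :* a :+ X :* (p :* b) :+ p :* c) refl (parity y) _ X _ _ ⟩
        t (r ℤ.+ + 1) y + X * t r y + t (r ℤ.- + 1) y ∎
        where
        s = r ℤ.- + K ℤ.* y

    periodised-neg : ∀ {n} (x : Vector Carrier n) → Invertible x → ∀ r →
                     periodised N K x (ℤ.- r) ≈ periodised N K x r
    periodised-neg x inv r = trans
      (∑-cong (interval N) λ y → *-cong
        (reflexive (≡.cong ((- 1#) ^_) (≡.sym (ℤ.∣-i∣≡∣i∣ y))))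
        (trans (reflexive (≡.cong (centred x) (-r-Ky r (+ K) y))) (centred-neg x inv (r ℤ.- + K ℤ.* ℤ.- y))))
      (∑-interval-neg N (λ y → parity y * centred x (r ℤ.- + K ℤ.* y)))

    -- Adding K to `r` amounts to replacing `y` by its predecessor, which changes the parity. For
    -- the truncated sum this leaves the terms at N and -N - 1; the hypothesis places both outside
    -- the support of `centred`.
    periodised-shift : ∀ {n} (x : Vector Carrier n) → Invertible x → ∀ r → n ℕ.+ ∣ r ∣ < K ℕ.* N →
                       periodised N K x (r ℤ.+ + K) ≈ - periodised N K x r
    periodised-shift {n} x inv r h = begin
      ∑[ Y ] (λ y → parity y * centred x (r ℤ.+ + K ℤ.- + K ℤ.* y))
        ≈⟨ ∑-cong Y (λ y → trans (*-cong (parity-pred y) (reflexive (≡.cong (centred x) (r+K-Ky r (+ K) y))))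
             (solve 2 (λ a b → (:- a) :* b := :- con (+ 1) :* (a :* b)) refl (parity (ℤ.pred y)) _)) ⟩
      ∑[ Y ] (λ y → - 1# * g (ℤ.pred y))
        ≈⟨ *-∑ Y (- 1#) (g ∘ ℤ.pred) ⟨
      - 1# * ∑[ Y ] (g ∘ ℤ.pred)
        ≈⟨ solve 1 (λ a → :- con (+ 1) :* a := :- (a :+ con (+ 0))) refl _ ⟩
      - (∑[ Y ] (g ∘ ℤ.pred) + 0#)
        ≈⟨ -‿cong (+-congˡ (g-vanishes (+ N) h)) ⟨
      - (∑[ Y ] (g ∘ ℤ.pred) + g (+ N))
        ≈⟨ -‿cong (∑-interval-pred N g) ⟩
      - (∑[ Y ] g + g (ℤ.pred (ℤ.- + N)))
        ≈⟨ -‿cong (trans (+-congˡ (g-vanishes (ℤ.pred (ℤ.- + N))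
             (ℕ.<-≤-trans h (ℕ.*-monoʳ-≤ K (N≤∣pred-N∣ N))))) (+-identityʳ _)) ⟩
      - ∑[ Y ] g ∎
      where
      Y = interval N
      g : ℤ → Carrier
      g y = parity y * centred x (r ℤ.- + K ℤ.* y)
      g-vanishes : ∀ y → n ℕ.+ ∣ r ∣ < K ℕ.* ∣ y ∣ → g y ≈ 0#
      g-vanishes y h = trans (*-congˡ (centred-support x inv (r ℤ.- + K ℤ.* y) (∣r-Ky∣-large K r y h))) (zeroʳ _)
      N≤∣pred-N∣ : ∀ N → N ≤ ∣ ℤ.pred (ℤ.- + N) ∣
      N≤∣pred-N∣ zero    = z≤n
      N≤∣pred-N∣ (suc N) = ℕ.n≤1+n (suc N)

    -- Without variables a term survives only if r = Ky, and |r| < K leaves y = 0.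
    periodised-[] : ∀ (x : Vector Carrier 0) r → ∣ r ∣ < K → periodised N K x r ≈ ė x r
    periodised-[] x r h = trans
      (∑-interval-centre N g (λ m → g-vanishes (+ suc m)) (λ m → g-vanishes -[1+ m ]))
      (trans (*-identityˡ _) (reflexive (≡.cong (ė x) (≡.trans (ℤ.+-identityˡ _)
        (≡.trans (≡.cong (λ s → r ℤ.- s) (ℤ.*-zeroʳ (+ K))) (ℤ.+-identityʳ r))))))
      where
      g : ℤ → Carrier
      g y = parity y * centred x (r ℤ.- + K ℤ.* y)
      g-vanishes : ∀ y .{{_ : ℕ.NonZero ∣ y ∣}} → g y ≈ 0#
      g-vanishes y = trans
        (*-congˡ (centred-support x (λ ()) (r ℤ.- + K ℤ.* y) (∣r-Ky∣-large K r y (ℕ.<-≤-trans h (ℕ.m≤m*n K ∣ y ∣)))))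
        (zeroʳ _)

  determinant-identity : ∀ {k} (M : Fin k → Fin k → Carrier) → (∀ i → M i i ≈ 1#) → (∀ i j → i ≢ j → M i j ≈ 0#) →
                         determinant M ≈ 1#
  determinant-identity {zero}  M M≈1 M≈0 = refl
  determinant-identity {suc k} M M≈1 M≈0 = begin
    1# * M zero zero * determinant (λ i j → M (suc i) (suc j))
      + sum (λ j → sign (suc j) * M zero (suc j) * determinant (λ i j′ → M (suc i) (punchIn (suc j) j′)))
      ≈⟨ +-cong
           (*-cong (*-congˡ (M≈1 zero))
             (determinant-identity (λ i j → M (suc i) (suc j)) (M≈1 ∘ suc) (λ i j i≢j → M≈0 _ _ (i≢j ∘ Fin.suc-injective))))
           (sum-zero {f = λ j → sign (suc j) * M zero (suc j) * determinant (λ i j′ → M (suc i) (punchIn (suc j) j′))}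
             (λ j → trans (*-congʳ (trans (*-congˡ (M≈0 zero (suc j) λ ())) (zeroʳ _))) (zeroˡ _))) ⟩
    1# * 1# * 1# + 0#
      ≈⟨ solve 0 (con (+ 1) :* con (+ 1) :* con (+ 1) :+ con (+ 0) := con (+ 1)) refl ⟩
    1# ∎

  coefficient : Corner → Carrier
  coefficient first = 1#
  coefficient last  = - 1#

  extraFirst extraLast : Corner → Carrier
  extraFirst first = 1#
  extraFirst last  = 0#
  extraLast  first = 0#
  extraLast  last  = 1#

  module _ (k : ℕ) where

    corner-matrix : Corner → Carrier → Fin k → Fin k → Carrier
    corner-matrix corner a = tridiagonal a (extraFirst corner) (extraLast corner) k

    position≤k : ∀ (i : Fin k) → ∣ position i ∣ ≤ k
    position≤k = Fin.toℕ<n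

    ∣-[k+i]∣≤2k : ∀ i → ∣ i ∣ ≤ k → ∣ ℤ.- (+ k ℤ.+ i) ∣ ≤ 2 ℕ.* k
    ∣-[k+i]∣≤2k i i≤k = ℕ.≤-trans (ℕ.≤-reflexive (ℤ.∣-i∣≡∣i∣ (+ k ℤ.+ i)))
      (ℕ.≤-trans (ℤ.∣i+j∣≤∣i∣+∣j∣ (+ k) i)
        (ℕ.+-monoʳ-≤ k (ℕ.≤-trans i≤k (ℕ.≤-reflexive (≡.sym (ℕ.+-identityʳ k))))))

    ∣-[k-i]∣≤2k : ∀ i → ∣ i ∣ ≤ k → ∣ ℤ.- (+ k ℤ.- i) ∣ ≤ 2 ℕ.* k
    ∣-[k-i]∣≤2k i i≤k = ∣-[k+i]∣≤2k (ℤ.- i) (ℕ.≤-trans (ℕ.≤-reflexive (ℤ.∣-i∣≡∣i∣ i)) i≤k)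

    j+i<K : ∀ (i j : Fin k) → suc (toℕ j) ℕ.+ suc (toℕ i) < 2 ℕ.* k ℕ.+ 1
    j+i<K i j = ℕ.≤-<-trans
      (ℕ.+-mono-≤ (position≤k j) (ℕ.≤-trans (position≤k i) (ℕ.≤-reflexive (≡.sym (ℕ.+-identityʳ k)))))
      (ℕ.m<m+n (2 ℕ.* k) (s≤s z≤n))

    ∣j-i∣<K : ∀ (i j : Fin k) → ∣ position j ℤ.- position i ∣ < 2 ℕ.* k ℕ.+ 1
    ∣j-i∣<K i j = ℕ.≤-<-trans (ℤ.∣i-j∣≤∣i∣+∣j∣ (position j) (position i)) (j+i<K i j)

    ∣j+i-offset∣<K : ∀ corner (i j : Fin k) → ∣ position j ℤ.+ position i ℤ.- offset corner ∣ < 2 ℕ.* k ℕ.+ 1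
    ∣j+i-offset∣<K first i j = ℕ.≤-<-trans (ℕ.n≤1+n _) (j+i<K i j)
    ∣j+i-offset∣<K last  i j = ≡.subst (λ r → ∣ r ∣ < 2 ℕ.* k ℕ.+ 1) (≡.sym (ℤ.+-identityʳ (position j ℤ.+ position i))) (j+i<K i j)

    j+i-offset≢0 : ∀ corner (i j : Fin k) → position j ℤ.+ position i ℤ.- offset corner ≢ + 0
    j+i-offset≢0 first i j eq = ℕ.m+1+n≢0 (toℕ j) (ℤ.+-injective eq)
    j+i-offset≢0 last  i j ()

  module _ (k N : ℕ) where

    b : ∀ {n} → Vector Carrier n → ℤ → Carrier
    b = periodised N (2 ℕ.* k ℕ.+ 1)

    -- The column index ranges over all natural numbers so that the columns 0 and k + 1 just outside
    -- the matrix make sense.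
    entry : Corner → ∀ {n} → Vector Carrier n → ℤ → ℕ → Carrier
    entry corner x i j = b x (+ j ℤ.- i) + coefficient corner * b x (+ j ℤ.+ i ℤ.- offset corner)

    module _ {n} (x : Vector Carrier n) (inv : Invertible x) (n+2k<N : n ℕ.+ 2 ℕ.* k < N) where

      b-neg : ∀ {r s} → r ≡ ℤ.- s → b x r ≈ b x s
      b-neg {s = s} ≡.refl = periodised-neg N (2 ℕ.* k ℕ.+ 1) x inv s

      -- The arguments to be shifted are -(k + i) and -(k - i), of absolute value at most 2k; this
      -- is the origin of the bound on `N`. It suffices because N is at most KN.
      b-shift : ∀ s {r} → ∣ s ∣ ≤ 2 ℕ.* k → r ≡ s ℤ.+ (+ 2 ℤ.* + k ℤ.+ + 1) → b x r ≈ - b x s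
      b-shift s s≤2k ≡.refl = trans
        (reflexive (≡.cong (λ K → b x (s ℤ.+ (K ℤ.+ + 1))) (≡.sym (ℤ.pos-* 2 k))))
        (periodised-shift N (2 ℕ.* k ℕ.+ 1) x inv s (ℕ.<-≤-trans (ℕ.≤-<-trans (ℕ.+-monoʳ-≤ n s≤2k) n+2k<N)
          (ℕ.≤-trans (ℕ.m≤m+n N (2 ℕ.* k ℕ.* N)) (ℕ.≤-reflexive (≡.cong (ℕ._* N) (ℕ.+-comm 1 (2 ℕ.* k)))))))

      -- By evenness of `b`, the row is symmetric under j ↦ 1 - j for `first`, which exchanges the
      -- columns 0 and 1, and antisymmetric under j ↦ -j for `last`, which fixes column 0.
      entry-left : ∀ corner i → entry corner x i 0 ≈ extraFirst corner * entry corner x i 1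
      entry-left first i = begin
        b x (+ 0 ℤ.- i) + 1# * b x (+ 0 ℤ.+ i ℤ.- + 1)
          ≈⟨ +-cong (b-neg (first-left i)) (*-congˡ (b-neg (first-left′ i))) ⟩
        b x (+ 1 ℤ.+ i ℤ.- + 1) + 1# * b x (+ 1 ℤ.- i)
          ≈⟨ solve 2 (λ c d → c :+ con (+ 1) :* d := con (+ 1) :* (d :+ con (+ 1) :* c)) refl
               (b x (+ 1 ℤ.+ i ℤ.- + 1)) (b x (+ 1 ℤ.- i)) ⟩
        1# * (b x (+ 1 ℤ.- i) + 1# * b x (+ 1 ℤ.+ i ℤ.- + 1)) ∎
      entry-left last  i = begin
        b x (+ 0 ℤ.- i) + - 1# * b x (+ 0 ℤ.+ i ℤ.- + 0)
          ≈⟨ +-congʳ (b-neg (last-left i)) ⟩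
        b x (+ 0 ℤ.+ i ℤ.- + 0) + - 1# * b x (+ 0 ℤ.+ i ℤ.- + 0)
          ≈⟨ solve 2 (λ c d → c :+ :- con (+ 1) :* c := con (+ 0) :* d) refl
               (b x (+ 0 ℤ.+ i ℤ.- + 0)) (entry last x i 1) ⟩
        0# * entry last x i 1 ∎

      -- Composing the reflection at the left end with the sign-changing shift by K = 2k + 1 gives
      -- antisymmetry under j ↦ 2k + 2 - j for `first`, fixing column k + 1, and symmetry under j ↦
      -- 2k + 1 - j for `last`, exchanging the columns k and k + 1. The two summands are compared
      -- directly, so no division by 2 occurs.
      entry-right : ∀ corner i → ∣ i ∣ ≤ k → entry corner x i (suc k) ≈ extraLast corner * entry corner x i k
      entry-right first i i≤k = begin
        b x (+ suc k ℤ.- i) + 1# * b x (+ suc k ℤ.+ i ℤ.- + 1)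
          ≈⟨ +-cong (b-shift (ℤ.- (+ k ℤ.+ i)) (∣-[k+i]∣≤2k k i i≤k) (right (+ k) i)) (*-congˡ (b-neg (first-right (+ k) i))) ⟩
        - b x (ℤ.- (+ k ℤ.+ i)) + 1# * b x (ℤ.- (+ k ℤ.+ i))
          ≈⟨ solve 2 (λ c d → :- c :+ con (+ 1) :* c := con (+ 0) :* d) refl
               (b x (ℤ.- (+ k ℤ.+ i))) (entry first x i k) ⟩
        0# * entry first x i k ∎
      entry-right last  i i≤k = begin
        b x (+ suc k ℤ.- i) + - 1# * b x (+ suc k ℤ.+ i ℤ.- + 0)
          ≈⟨ +-cong (b-shift (ℤ.- (+ k ℤ.+ i)) (∣-[k+i]∣≤2k k i i≤k) (right (+ k) i))
               (*-congˡ (b-shift (ℤ.- (+ k ℤ.- i)) (∣-[k-i]∣≤2k k i i≤k) (last-right′ (+ k) i))) ⟩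
        - b x (ℤ.- (+ k ℤ.+ i)) + - 1# * - b x (ℤ.- (+ k ℤ.- i))
          ≈⟨ +-cong (-‿cong (sym (b-neg (last-right (+ k) i)))) (*-congˡ (-‿cong (b-neg {s = + k ℤ.- i} ≡.refl))) ⟩
        - b x (+ k ℤ.+ i ℤ.- + 0) + - 1# * - b x (+ k ℤ.- i)
          ≈⟨ solve 2 (λ c d → :- c :+ :- con (+ 1) :* (:- d) := con (+ 1) :* (d :+ :- con (+ 1) :* c)) refl
               (b x (+ k ℤ.+ i ℤ.- + 0)) (b x (+ k ℤ.- i)) ⟩
        1# * entry last x i k ∎

    -- Both arguments of `b` contain j with coefficient 1, so the three-term relation in r becomes
    -- the same relation in j and leaves the row index alone.
    entry-suc : ∀ corner {n} (x : Vector Carrier (suc n)) → Invertible x → ∀ i j →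
      entry corner x i (suc j) ≈ entry corner (x ∘ suc) i j + (x zero + x zero ⁻¹) * entry corner (x ∘ suc) i (suc j)
                                 + entry corner (x ∘ suc) i (suc (suc j))
    entry-suc corner x inv i j = begin
      b x r + s * b x t
        ≈⟨ +-cong (periodised-suc N (2 ℕ.* k ℕ.+ 1) x inv r) (*-congˡ (periodised-suc N (2 ℕ.* k ℕ.+ 1) x inv t)) ⟩
      (a (r ℤ.+ + 1) + X * a r + a (r ℤ.- + 1)) + s * (a (t ℤ.+ + 1) + X * a t + a (t ℤ.- + 1))
        ≡⟨ ≡.cong₂ _+_
             (≡.cong₂ (λ p q → a p + X * a r + a q) (≡.sym (j-i+1 (+ suc j) i)) (≡.sym (1+j-i-1 (+ j) i)))
             (≡.cong₂ (λ p q → s * (a p + X * a t + a q)) (≡.sym (j+i-d+1 (+ suc j) i d)) (≡.sym (1+j+i-d-1 (+ j) i d))) ⟩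
      (a (+ suc (suc j) ℤ.- i) + X * a r + a (+ j ℤ.- i))
        + s * (a (+ suc (suc j) ℤ.+ i ℤ.- d) + X * a t + a (+ j ℤ.+ i ℤ.- d))
        ≈⟨ solve 8 (λ s X a b c a′ b′ c′ → (a :+ X :* b :+ c) :+ s :* (a′ :+ X :* b′ :+ c′)
             := (c :+ s :* c′) :+ X :* (b :+ s :* b′) :+ (a :+ s :* a′)) refl
             s X (a (+ suc (suc j) ℤ.- i)) (a r) (a (+ j ℤ.- i))
             (a (+ suc (suc j) ℤ.+ i ℤ.- d)) (a t) (a (+ j ℤ.+ i ℤ.- d)) ⟩
      entry corner (x ∘ suc) i j + X * entry corner (x ∘ suc) i (suc j) + entry corner (x ∘ suc) i (suc (suc j)) ∎
      where
      d r t : ℤ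
      d = offset corner
      r = + suc j ℤ.- i
      t = + suc j ℤ.+ i ℤ.- d
      s X : Carrier
      s = coefficient corner
      X = x zero + x zero ⁻¹
      a : ℤ → Carrier
      a = b (x ∘ suc)

    entries : Corner → ∀ {n} → Vector Carrier n → Fin k → Fin k → Carrier
    entries corner x i j = entry corner x (position i) (suc (toℕ j))

    entries-suc : ∀ corner {n} (x : Vector Carrier (suc n)) → Invertible x → n ℕ.+ 2 ℕ.* k < N → ∀ i j →
      entries corner x i j ≈ combination (entries corner (x ∘ suc) i) (corner-matrix k corner (x zero + x zero ⁻¹)) j
    entries-suc corner x inv n+2k<N i j = trans (entry-suc corner x inv (position i) (toℕ j)) (sym (trans
      (sum-tridiagonal k X p (extraLast corner) m (entry-right (x ∘ suc) (inv ∘ suc) n+2k<N corner (position i) (position≤k k i)) j)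
      (+-congʳ (+-congʳ (left≈ j)))))
      where
      X p : Carrier
      X = x zero + x zero ⁻¹
      p = extraFirst corner
      m : ℕ → Carrier
      m = entry corner (x ∘ suc) (position i)
      left≈ : ∀ {k} (j : Fin k) → left p m j ≈ m (toℕ j)
      left≈ zero    = sym (entry-left (x ∘ suc) (inv ∘ suc) n+2k<N corner (position i))
      left≈ (suc j) = refl

    -- All indices have absolute value below K, where `b` without variables is the indicator of 0.
    -- Positions start at 1, so j + i - d is positive and only j - i on the diagonal contributes:
    -- the matrix is the identity.
    entries-[] : ∀ corner (x : Vector Carrier 0) → determinant (entries corner x) ≈ 1#
    entries-[] corner x = determinant-identity (entries corner x)
      (λ i → trans (+-cong (diagonal i) (*-congˡ (second i i))) (trans (+-congˡ (zeroʳ _)) (+-identityʳ 1#)))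
      (λ i j i≢j → trans (+-cong (off-diagonal i j i≢j) (*-congˡ (second i j))) (trans (+-congˡ (zeroʳ _)) (+-identityʳ 0#)))
      where
      ė-[] : ∀ r → r ≢ + 0 → ė x r ≈ 0#
      ė-[] (+ zero)  r≢0 = contradiction ≡.refl r≢0
      ė-[] (+ suc r) r≢0 = refl
      ė-[] -[1+ r ]  r≢0 = refl

      b-[] : ∀ r → ∣ r ∣ < 2 ℕ.* k ℕ.+ 1 → b x r ≈ ė x r
      b-[] = periodised-[] N (2 ℕ.* k ℕ.+ 1) x

      diagonal : ∀ i → b x (position i ℤ.- position i) ≈ 1#
      diagonal i = trans (b-[] (position i ℤ.- position i) (∣j-i∣<K k i i))
        (trans (reflexive (≡.cong (ė x) (ℤ.+-inverseʳ (position i))))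
          (trans (+-identityʳ _) refl))

      off-diagonal : ∀ i j → i ≢ j → b x (position j ℤ.- position i) ≈ 0#
      off-diagonal i j i≢j = trans (b-[] (position j ℤ.- position i) (∣j-i∣<K k i j))
        (ė-[] _ λ eq → i≢j (≡.sym (Fin.toℕ-injective (ℕ.suc-injective (ℤ.+-injective (ℤ.i-j≡0⇒i≡j (position j) (position i) eq))))))

      second : ∀ i j → b x (position j ℤ.+ position i ℤ.- offset corner) ≈ 0#
      second i j = trans (b-[] (position j ℤ.+ position i ℤ.- offset corner) (∣j+i-offset∣<K k corner i j))
        (ė-[] (position j ℤ.+ position i ℤ.- offset corner) (j+i-offset≢0 k corner i j))

    determinant-entries : ∀ corner {n} (x : Vector Carrier n) → Invertible x → n ℕ.+ 2 ℕ.* k < N →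
      determinant (entries corner x) ≈ product (λ i → determinant (corner-matrix k corner (x i + x i ⁻¹)))
    determinant-entries corner {zero}  x inv n+2k<N = entries-[] corner x
    determinant-entries corner {suc n} x inv n+2k<N = begin
      determinant (entries corner x)
        ≈⟨ determinant-cong (entries-suc corner x inv n+2k<N′) ⟩
      determinant (λ i → combination (entries corner (x ∘ suc) i) (corner-matrix k corner (x zero + x zero ⁻¹)))
        ≈⟨ determinant-* (entries corner (x ∘ suc)) _ ⟩
      determinant (entries corner (x ∘ suc)) * determinant (corner-matrix k corner (x zero + x zero ⁻¹))
        ≈⟨ *-congʳ (determinant-entries corner (x ∘ suc) (inv ∘ suc) n+2k<N′) ⟩
      product (λ i → determinant (corner-matrix k corner (x (suc i) + x (suc i) ⁻¹)))
        * determinant (corner-matrix k corner (x zero + x zero ⁻¹))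
        ≈⟨ *-comm _ _ ⟩
      product (λ i → determinant (corner-matrix k corner (x i + x i ⁻¹))) ∎
      where
      n+2k<N′ : n ℕ.+ 2 ℕ.* k < N
      n+2k<N′ = ℕ.<-trans (ℕ.n<1+n _) n+2k<N

-- Rectangular partitions and the symmetrisation at t = 1.

length-filter-replicate : ∀ {a p} {A : Set a} {P : A → Set p} (P? : ∀ z → Dec (P z)) n z →
  length (filter P? (List.tabulate {n = n} (λ _ → z))) ≡ (if does (P? z) then n else 0)
length-filter-replicate P? zero    z with does (P? z)
... | true  = ≡.refl
... | false = ≡.refl
length-filter-replicate P? (suc n) z with does (P? z) | length-filter-replicate P? n z
... | true  | ih = ≡.cong suc ih
... | false | ih = ih

module _ (k n : ℕ) where
  open Partition (rectangle k n)

  l-rectangle : l ≡ (if does (0 ℕ.<? k) then n else 0)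
  l-rectangle = length-filter-replicate (0 ℕ.<?_) n k

  m-rectangle : ∀ i → m i ≡ (if does (k ℕ.≟ i) then n else 0)
  m-rectangle i = length-filter-replicate (ℕ._≟ i) n k

  largest-rectangle : 1 ≤ n → largest ≡ k
  largest-rectangle (s≤s {n = n} _) = go n
    where
    go : ∀ n → Vector.foldr ℕ._⊔_ 0 {suc n} (λ _ → k) ≡ k
    go zero    = ℕ.⊔-identityʳ k
    go (suc n) = ≡.trans (≡.cong (k ℕ.⊔_) (go n)) (ℕ.⊔-idem k)

module Symmetrisation {c ℓ} (F : Field c ℓ) (char0 : CharacteristicZero F) where
  open Field F hiding (zero)
  open Over F
  open Determinants F
  open ListSums F
  open RawSemiringDefinitions rawSemiring using (_^_; product) renaming (_×_ to _·_)
  open IntegerCoefficients commutativeRing using (solve; _:=_; _:+_; _:*_; _:-_; :-_; con)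
  open import Relation.Binary.Reasoning.Setoid setoid
  module Product = CommutativeMonoidSum *-commutativeMonoid

  product-cong : ∀ {n} {f g : Vector Carrier n} → (∀ i → f i ≈ g i) → product f ≈ product g
  product-cong = Product.sum-cong-≋

  product-one : ∀ {n} {f : Vector Carrier n} → (∀ i → f i ≈ 1#) → product f ≈ 1#
  product-one {n} f≈1 = trans (product-cong f≈1) (Product.sum-replicate-zero n)

  *-cancelˡ : ∀ {a b d} → ¬ (a ≈ 0#) → a * b ≈ a * d → b ≈ d
  *-cancelˡ {a} {b} {d} a≉0 ab≈ad = begin
    b               ≈⟨ step b ⟨
    a ⁻¹ * (a * b)  ≈⟨ *-congˡ ab≈ad ⟩
    a ⁻¹ * (a * d)  ≈⟨ step d ⟩
    d               ∎
    where
    step : ∀ b → a ⁻¹ * (a * b) ≈ b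
    step b = trans (solve 3 (λ i a b → i :* (a :* b) := (a :* i) :* b) refl (a ⁻¹) a b)
      (trans (*-congʳ (inverseʳ a≉0)) (*-identityˡ b))

  *-≉0 : ∀ {a b} → ¬ (a ≈ 0#) → ¬ (b ≈ 0#) → ¬ (a * b ≈ 0#)
  *-≉0 a≉0 b≉0 ab≈0 = b≉0 (*-cancelˡ a≉0 (trans ab≈0 (sym (zeroʳ _))))

  product-≉0 : ∀ {n} {f : Vector Carrier n} → (∀ i → ¬ (f i ≈ 0#)) → ¬ (product f ≈ 0#)
  product-≉0 {zero}  f≉0 = 1≉0
  product-≉0 {suc n} f≉0 = *-≉0 (f≉0 zero) (product-≉0 (f≉0 ∘ suc))

  -≈0⇒≈ : ∀ {a b} → a - b ≈ 0# → a ≈ b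
  -≈0⇒≈ {a} {b} a-b≈0 = trans (solve 2 (λ a b → a := (a :- b) :+ b) refl a b) (trans (+-congʳ a-b≈0) (+-identityˡ b))

  unit-≉0 : ∀ {a b} → a * b ≈ 1# → ¬ (a ≈ 0#)
  unit-≉0 ab≈1 a≈0 = 1≉0 (trans (sym ab≈1) (trans (*-congʳ a≈0) (zeroˡ _)))

  ⁻¹-unique : ∀ {a b} → a * b ≈ 1# → a ⁻¹ ≈ b
  ⁻¹-unique ab≈1 = *-cancelˡ (unit-≉0 ab≈1) (trans (inverseʳ (unit-≉0 ab≈1)) (sym ab≈1))

  1^≈1 : ∀ m → 1# ^ m ≈ 1#
  1^≈1 zero    = refl
  1^≈1 (suc m) = trans (*-identityˡ _) (1^≈1 m)

  geometric-1 : ∀ m → geometric m 1# ≈ m · 1#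
  geometric-1 m = trans (sum-cong {m} λ j → 1^≈1 (toℕ j)) (Sum.sum-replicate m)

  qFactorial-suc : ∀ m → qFactorial (suc m) 1# ≈ (suc m · 1#) * qFactorial m 1#
  qFactorial-suc m = begin
    qFactorial (suc m) 1#
      ≈⟨ Product.sum-init-last {m} (λ i → geometric (suc (toℕ i)) 1#) ⟩
    product {m} (λ i → geometric (suc (toℕ (inject₁ i))) 1#) * geometric (suc (toℕ (fromℕ m))) 1#
      ≈⟨ *-cong (product-cong {m} λ i → reflexive (≡.cong (λ j → geometric (suc j) 1#) (Fin.toℕ-inject₁ i)))
           (reflexive (≡.cong (λ j → geometric (suc j) 1#) (Fin.toℕ-fromℕ m))) ⟩
    qFactorial m 1# * geometric (suc m) 1#
      ≈⟨ trans (*-comm _ _) (*-congʳ (geometric-1 (suc m))) ⟩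
    (suc m · 1#) * qFactorial m 1# ∎

  -- At t = 1 the factors are the numbers 1 to m, which are nonzero in characteristic zero.
  qFactorial-≉0 : ∀ m → ¬ (qFactorial m 1# ≈ 0#)
  qFactorial-≉0 m = product-≉0 {m} λ i eq → char0 (toℕ i) (trans (sym (geometric-1 (suc (toℕ i)))) eq)

  pochhammer-0 : ∀ {a} t m → a ≈ 0# → pochhammer a t m ≈ 1#
  pochhammer-0 t m a≈0 = product-one {m} λ i →
    trans (+-congˡ (-‿cong (trans (*-congʳ a≈0) (zeroˡ _)))) (solve 0 (con (+ 1) :- con (+ 0) := con (+ 1)) refl)

  -- The value is n! for two different reasons: if k = 0, all n parts are missing and the product
  -- over multiplicities is empty; if k > 0, none is missing and only the multiplicity of k
  -- contributes.
  v-rectangle : ∀ k n → 1 ≤ n → v (rectangle k n) 1# ≈ qFactorial n 1#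
  v-rectangle k n 1≤n = begin
    qFactorial (n ℕ.∸ l) 1# * product {largest} (λ i → qFactorial (m (suc (toℕ i))) 1#)
      ≡⟨ ≡.cong₂ (λ a b → qFactorial (n ℕ.∸ a) 1# * product {b} (λ i → qFactorial (m (suc (toℕ i))) 1#))
           (l-rectangle k n) (largest-rectangle k n 1≤n) ⟩
    qFactorial (n ℕ.∸ (if does (0 ℕ.<? k) then n else 0)) 1# * product {k} (λ i → qFactorial (m (suc (toℕ i))) 1#)
      ≈⟨ *-congˡ (product-cong {k} λ i → reflexive (≡.cong (λ a → qFactorial a 1#) (m-rectangle k n (suc (toℕ i))))) ⟩
    qFactorial (n ℕ.∸ (if does (0 ℕ.<? k) then n else 0)) 1#
      * product {k} (λ i → qFactorial (if does (k ℕ.≟ suc (toℕ i)) then n else 0) 1#)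
      ≈⟨ go k ⟩
    qFactorial n 1# ∎
    where
    open Partition (rectangle k n)
    go : ∀ k → qFactorial (n ℕ.∸ (if does (0 ℕ.<? k) then n else 0)) 1#
               * product {k} (λ i → qFactorial (if does (k ℕ.≟ suc (toℕ i)) then n else 0) 1#) ≈ qFactorial n 1#
    go zero    = *-identityʳ _
    go (suc k) = begin
      qFactorial (n ℕ.∸ n) 1# * product {suc k} f
        ≈⟨ *-cong (reflexive (≡.cong (λ a → qFactorial a 1#) (ℕ.n∸n≡0 n))) (Product.sum-init-last {k} f) ⟩
      1# * (product {k} (f ∘ inject₁) * f (fromℕ k))
        ≈⟨ trans (*-identityˡ _) (*-congʳ (product-one {k} {f ∘ inject₁} other)) ⟩
      1# * f (fromℕ k)
        ≈⟨ trans (*-identityˡ _) (reflexive (≡.cong (λ b → qFactorial (if b then n else 0) 1#)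
             (dec-true (suc k ℕ.≟ suc (toℕ (fromℕ k))) (≡.cong suc (≡.sym (Fin.toℕ-fromℕ k)))))) ⟩
      qFactorial n 1# ∎
      where
      f : Vector Carrier (suc k)
      f i = qFactorial (if does (suc k ℕ.≟ suc (toℕ i)) then n else 0) 1#
      other : ∀ i → f (inject₁ i) ≈ 1#
      other i = reflexive (≡.cong (λ b → qFactorial (if b then n else 0) 1#)
        (dec-false (suc k ℕ.≟ suc (toℕ (inject₁ i)))
          (λ eq → ℕ.<⇒≢ (Fin.toℕ<n i) (≡.sym (≡.trans (ℕ.suc-injective eq) (Fin.toℕ-inject₁ i))))))

  ∑-cartesianProductWith : ∀ {a b d} {A : Set a} {B : Set b} {D : Set d} (h : A → B → D) as bs (f : D → Carrier) →
    ∑[ cartesianProductWith h as bs ] f ≈ ∑[ as ] λ i → ∑[ bs ] λ j → f (h i j)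
  ∑-cartesianProductWith h []       bs f = refl
  ∑-cartesianProductWith h (i ∷ as) bs f = trans (∑-++ (List.map (h i) bs) _ f)
    (+-cong (reflexive (∑-map (h i) bs f)) (∑-cartesianProductWith h as bs f))

  ∑-* : ∀ {a} {A : Set a} as (f : A → Carrier) b → ∑[ as ] (λ i → f i * b) ≈ ∑[ as ] f * b
  ∑-* as f b = trans (∑-cong as λ i → *-comm (f i) b) (trans (sym (*-∑ as b f)) (*-comm b _))

  ∑-const : ∀ {a} {A : Set a} (as : List A) b → ∑[ as ] (λ _ → b) ≈ (length as · 1#) * b
  ∑-const []       b = sym (zeroˡ b)
  ∑-const (i ∷ as) b = trans (+-congˡ (∑-const as b))
    (solve 2 (λ m b → b :+ m :* b := (con (+ 1) :+ m) :* b) refl (length as · 1#) b)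

  ∑-tuples-product : ∀ {a} {A : Set a} as n (f : Fin n → A → Carrier) →
    ∑[ tuples as n ] (λ y → product λ i → f i (lookup y i)) ≈ product λ i → ∑[ as ] (f i)
  ∑-tuples-product as zero    f = +-identityʳ _
  ∑-tuples-product as (suc n) f = begin
    ∑[ tuples as (suc n) ] (λ y → product λ i → f i (lookup y i))
      ≈⟨ ∑-cartesianProductWith Vec._∷_ as (tuples as n) _ ⟩
    ∑[ as ] (λ z → ∑[ tuples as n ] λ y → f zero z * product (λ i → f (suc i) (lookup y i)))
      ≈⟨ ∑-cong as (λ z → trans (sym (*-∑ (tuples as n) (f zero z) _)) (*-congˡ (∑-tuples-product as n (f ∘ suc)))) ⟩
    ∑[ as ] (λ z → f zero z * product (λ i → ∑[ as ] (f (suc i))))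
      ≈⟨ ∑-* as (f zero) _ ⟩
    product (λ i → ∑[ as ] (f i)) ∎

  -- The number n! of permutations is written as `qFactorial n 1#`, the form in which it cancels
  -- against `v`.
  ∑-permutations : ∀ n b → ∑[ permutations n ] (λ _ → b) ≈ qFactorial n 1# * b
  ∑-permutations zero    b = trans (+-identityʳ b) (sym (*-identityˡ b))
  ∑-permutations (suc n) b = begin
    ∑[ permutations (suc n) ] (λ _ → b)
      ≈⟨ ∑-cartesianProductWith (Permutation.insert zero) (allFin (suc n)) (permutations n) (λ _ → b) ⟩
    ∑[ allFin (suc n) ] (λ _ → ∑[ permutations n ] (λ _ → b))
      ≈⟨ ∑-cong (allFin (suc n)) (λ _ → ∑-permutations n b) ⟩
    ∑[ allFin (suc n) ] (λ _ → qFactorial n 1# * b)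
      ≈⟨ ∑-const (allFin (suc n)) _ ⟩
    (length (allFin (suc n)) · 1#) * (qFactorial n 1# * b)
      ≡⟨ ≡.cong (λ m → (m · 1#) * (qFactorial n 1# * b)) (List.length-tabulate {n = suc n} id) ⟩
    (suc n · 1#) * (qFactorial n 1# * b)
      ≈⟨ *-assoc _ _ _ ⟨
    (suc n · 1#) * qFactorial n 1# * b
      ≈⟨ *-congʳ (qFactorial-suc n) ⟨
    qFactorial (suc n) 1# * b ∎

  power : Sign → Carrier → Carrier
  power Sign.+ a = a
  power Sign.- a = a ⁻¹

  act-coordinate : ∀ {n} (w : W n) (x : Vector Carrier n) i →
                   act w (λ z → z i) x ≡ power (lookup (proj₂ w) i) (x (proj₁ w ⟨$⟩ʳ i))
  act-coordinate (σ , ε) x i with lookup ε i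
  ... | Sign.+ = ≡.refl
  ... | Sign.- = ≡.refl

  Separated : Carrier → Carrier → Set ℓ
  Separated a b = ¬ (a ≈ b) × ¬ (a * b ≈ 1#)

  Separated-sym : ∀ {a b} → Separated a b → Separated b a
  Separated-sym (a≉b , ab≉1) = a≉b ∘ sym , ab≉1 ∘ trans (*-comm _ _)

  -- Inverting one entry exchanges the two conditions, which is why they are carried as a pair.
  Separated-power : ∀ s {a b} → ¬ (a ≈ 0#) → Separated a b → Separated (power s a) b
  Separated-power Sign.+         a≉0 sep          = sep
  Separated-power Sign.- {a} {b} a≉0 (a≉b , ab≉1) =
    (λ a⁻¹≈b → ab≉1 (trans (*-congˡ (sym a⁻¹≈b)) (inverseʳ a≉0))) ,
    (λ a⁻¹b≈1 → a≉b (sym (trans (sym (*-identityˡ b)) (trans (*-congʳ (sym (inverseʳ a≉0)))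
      (trans (*-assoc _ _ _) (trans (*-congˡ a⁻¹b≈1) (*-identityʳ a)))))))

  pair-factor : ∀ {a b} → Separated a b →
    (1# * a - b) * (1# - 1# * a * b) / ((a - b) * (1# - a * b)) ≈ 1#
  pair-factor {a} {b} (a≉b , ab≉1) = trans
    (*-congʳ (solve 2 (λ a b → (con (+ 1) :* a :- b) :* (con (+ 1) :- con (+ 1) :* a :* b)
                           := (a :- b) :* (con (+ 1) :- a :* b)) refl a b))
    (inverseʳ (*-≉0 (λ eq → a≉b (-≈0⇒≈ eq)) (λ eq → ab≉1 (sym (-≈0⇒≈ eq)))))

  if-one : ∀ {p} {P : Set p} (P? : Dec P) {a} → (P → a ≈ 1#) → (if does P? then a else 1#) ≈ 1#
  if-one (yes p) a≈1 = a≈1 p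
  if-one (no _)  a≈1 = refl

  module _ {n} (x : Vector Carrier n) (generic : Generic x) (k : ℕ) {s₁ s₂ : Carrier}
           (s₁s₂≈0 : s₁ * s₂ ≈ 0#) (numerator : ∀ z → (1# - s₁ * z) * (1# - s₂ * z) ≈ 1# + z) where
    open Generic generic

    factor : Carrier → Carrier
    factor z = (z ⁻¹) ^ k * ((1# - s₁ * z) * (1# - s₂ * z) / (1# - z ^ 2))

    pairs : Vector Carrier n → Carrier
    pairs y = product λ i → product λ j →
      if does (i Fin.<? j)
      then (1# * y i - y j) * (1# - 1# * y i * y j) / ((y i - y j) * (1# - y i * y j))
      else 1#

    pairs≈1 : ∀ y → (∀ i j → i ≢ j → Separated (y i) (y j)) → pairs y ≈ 1#
    pairs≈1 y sep = product-one {n} λ i → product-one {n} λ j →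
      if-one (i Fin.<? j) (λ i<j → pair-factor (sep i j (Fin.<⇒≢ i<j)))

    image : W n → Vector Carrier n
    image w i = act w (λ z → z i) x

    image-separated : ∀ w i j → i ≢ j → Separated (image w i) (image w j)
    image-separated w@(σ , ε) i j i≢j = ≡.subst₂ Separated (≡.sym (act-coordinate w x i)) (≡.sym (act-coordinate w x j))
      (Separated-power (lookup ε i) (xᵢ≉0 _) (Separated-sym (Separated-power (lookup ε j) (xᵢ≉0 _)
        (Separated-sym (xᵢ≉xⱼ _ _ σi≢σj , xᵢxⱼ≉1 _ _ σi≢σj)))))
      where
      σi≢σj : σ ⟨$⟩ʳ i ≢ σ ⟨$⟩ʳ j
      σi≢σj eq = i≢j (≡.trans (≡.sym (Permutation.inverseˡ σ)) (≡.trans (≡.cong (σ ⟨$⟩ˡ_) eq) (Permutation.inverseˡ σ)))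

    symmetrised : Carrier → Carrier
    symmetrised z = ∑[ Sign.+ ∷ Sign.- ∷ [] ] λ s → factor (power s z)

    -- Once the pair factors are gone, the summand is a product over the coordinates. The sum over
    -- sign vectors therefore factorises, and a permutation merely reorders the resulting product,
    -- so all n! of them contribute equally.
    ∑-elementsW : ∑[ elementsW n ] (λ w → product (λ i → factor (image w i)) * pairs (image w))
                    ≈ qFactorial n 1# * product (λ i → symmetrised (x i))
    ∑-elementsW = begin
      ∑[ elementsW n ] (λ w → product (λ i → factor (image w i)) * pairs (image w))
        ≈⟨ ∑-cong (elementsW n) (λ w → trans (*-congˡ (pairs≈1 (image w) (image-separated w)))
             (trans (*-identityʳ _) (product-cong λ i → reflexive (≡.cong factor (act-coordinate w x i))))) ⟩
      ∑[ elementsW n ] (λ w → product λ i → factor (power (lookup (proj₂ w) i) (x (proj₁ w ⟨$⟩ʳ i))))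
        ≈⟨ ∑-cartesianProductWith _,_ (permutations n) (tuples (Sign.+ ∷ Sign.- ∷ []) n) _ ⟩
      ∑[ permutations n ] (λ σ → ∑[ tuples (Sign.+ ∷ Sign.- ∷ []) n ] λ ε →
        product λ i → factor (power (lookup ε i) (x (σ ⟨$⟩ʳ i))))
        ≈⟨ ∑-cong (permutations n) (λ σ → ∑-tuples-product (Sign.+ ∷ Sign.- ∷ []) n (λ i s → factor (power s (x (σ ⟨$⟩ʳ i))))) ⟩
      ∑[ permutations n ] (λ σ → product λ i → symmetrised (x (σ ⟨$⟩ʳ i)))
        ≈⟨ ∑-cong (permutations n) (λ σ → sym (Product.sum-permute (symmetrised ∘ x) σ)) ⟩
      ∑[ permutations n ] (λ _ → product λ i → symmetrised (x i))
        ≈⟨ ∑-permutations n _ ⟩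
      qFactorial n 1# * product (λ i → symmetrised (x i)) ∎

    P-BC-rectangle : 1 ≤ n → P-BC (rectangle k n) x 1# s₁ s₂ ≈ product λ i → symmetrised (x i)
    P-BC-rectangle 1≤n = begin
      d ⁻¹ * ∑[ elementsW n ] (λ w → product (λ i → factor (image w i)) * pairs (image w))
        ≈⟨ *-cong (⁻¹-cong d≈q) ∑-elementsW ⟩
      q ⁻¹ * (q * product (λ i → symmetrised (x i)))
        ≈⟨ trans (sym (*-assoc _ _ _)) (*-congʳ (trans (*-comm _ _) (inverseʳ (qFactorial-≉0 n)))) ⟩
      1# * product (λ i → symmetrised (x i))
        ≈⟨ *-identityˡ _ ⟩
      product (λ i → symmetrised (x i)) ∎
      where
      open Partition (rectangle k n) using (l)
      d q : Carrier
      d = pochhammer (s₁ * s₂) 1# (n ℕ.∸ l) * v (rectangle k n) 1#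
      q = qFactorial n 1#
      d≈q : d ≈ q
      d≈q = trans (*-cong (pochhammer-0 1# (n ℕ.∸ l) s₁s₂≈0) (v-rectangle k n 1≤n)) (*-identityˡ q)

    -- With y the inverse of z, the two summands are z^(-k) / (1 - z) and z^k / (1 - y), and (1 - z)
    -- / (1 - y) = -z.
    symmetrised-value : ∀ i → (1# - x i) * symmetrised (x i) ≈ (x i ⁻¹) ^ k - x i ^ suc k
    symmetrised-value i = begin
      (1# - z) * (factor z + (factor y + 0#))
        ≈⟨ trans (*-congˡ (+-congˡ (+-identityʳ _))) (distribˡ _ _ _) ⟩
      (1# - z) * (y ^ k * ((1# - s₁ * z) * (1# - s₂ * z) * r)) + (1# - z) * ((y ⁻¹) ^ k * ((1# - s₁ * y) * (1# - s₂ * y) * r′))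
        ≈⟨ +-cong (*-congˡ (*-congˡ (*-congʳ (numerator z)))) (*-congˡ (*-cong (^-cong k (⁻¹-unique (trans (*-comm y z) zy≈1))) (*-congʳ (numerator y)))) ⟩
      (1# - z) * (y ^ k * ((1# + z) * r)) + (1# - z) * (z ^ k * ((1# + y) * r′))
        ≈⟨ +-cong first-term second-term ⟩
      y ^ k - z * z ^ k ∎
      where
      z y r r′ : Carrier
      z = x i
      y = x i ⁻¹
      r = (1# - z ^ 2) ⁻¹
      r′ = (1# - y ^ 2) ⁻¹

      ^-cong : ∀ k {a b} → a ≈ b → a ^ k ≈ b ^ k
      ^-cong zero    a≈b = refl
      ^-cong (suc k) a≈b = *-cong a≈b (^-cong k a≈b)

      zy≈1 : z * y ≈ 1#
      zy≈1 = inverseʳ (xᵢ≉0 i)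

      r-inverse : (1# - z ^ 2) * r ≈ 1#
      r-inverse = inverseʳ λ eq → xᵢ²≉1 i (sym (-≈0⇒≈ eq))

      r′-inverse : (1# - y ^ 2) * r′ ≈ 1#
      r′-inverse = inverseʳ λ eq → xᵢ²≉1 i (begin
        z ^ 2                ≈⟨ *-identityʳ _ ⟨
        z ^ 2 * 1#           ≈⟨ *-congˡ (-≈0⇒≈ eq) ⟩
        z ^ 2 * y ^ 2        ≈⟨ solve 2 (λ z y → (z :* (z :* con (+ 1))) :* (y :* (y :* con (+ 1))) := (z :* y) :* (z :* y)) refl z y ⟩
        (z * y) * (z * y)    ≈⟨ *-cong zy≈1 zy≈1 ⟩
        1# * 1#              ≈⟨ *-identityˡ 1# ⟩
        1#                   ∎)

      first-term : (1# - z) * (y ^ k * ((1# + z) * r)) ≈ y ^ k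
      first-term = begin
        (1# - z) * (y ^ k * ((1# + z) * r))
          ≈⟨ solve 3 (λ z Y r → (con (+ 1) :- z) :* (Y :* ((con (+ 1) :+ z) :* r))
                := Y :* ((con (+ 1) :- z :* (z :* con (+ 1))) :* r)) refl z (y ^ k) r ⟩
        y ^ k * ((1# - z ^ 2) * r)
          ≈⟨ trans (*-congˡ r-inverse) (*-identityʳ _) ⟩
        y ^ k ∎

      second-term : (1# - z) * (z ^ k * ((1# + y) * r′)) ≈ - (z * z ^ k)
      second-term = begin
        (1# - z) * (z ^ k * ((1# + y) * r′))
          -- The identity holds only modulo z y = 1, so an explicit multiple of `1# - z * y` is
          -- split off for the solver.
          ≈⟨ solve 4 (λ z y Z r → (con (+ 1) :- z) :* (Z :* ((con (+ 1) :+ y) :* r))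
                := (:- (z :* Z)) :* ((con (+ 1) :- y :* (y :* con (+ 1))) :* r)
                   :+ (con (+ 1) :- z :* y) :* (con (+ 1) :+ y) :* (Z :* r)) refl z y (z ^ k) r′ ⟩
        - (z * z ^ k) * ((1# - y ^ 2) * r′) + (1# - z * y) * (1# + y) * (z ^ k * r′)
          ≈⟨ +-cong (trans (*-congˡ r′-inverse) (*-identityʳ _))
               (trans (*-congʳ (trans (*-congʳ (trans (+-congˡ (-‿cong zy≈1)) (-‿inverseʳ 1#))) (zeroˡ _))) (zeroˡ _)) ⟩
        - (z * z ^ k) + 0#
          ≈⟨ +-identityʳ _ ⟩
        - (z * z ^ k) ∎

    1-xᵢ≉0 : ∀ i → ¬ (1# - x i ≈ 0#)
    1-xᵢ≉0 i eq = xᵢ²≉1 i (trans (*-cong x≈1 (*-congʳ x≈1)) (trans (*-identityˡ _) (*-identityˡ _)))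
      where
      x≈1 : x i ≈ 1#
      x≈1 = sym (-≈0⇒≈ eq)

-- Summation inside the determinant and comparison of the two sides.

module Assembly {c ℓ} (F : Field c ℓ) (char0 : CharacteristicZero F) where
  open Field F hiding (zero)
  open Over F
  open Determinants F
  open Tridiagonal F
  open ListSums F
  open Periodisation F
  open Symmetrisation F char0
  open RawSemiringDefinitions rawSemiring using (_^_; product)
  open IntegerCoefficients commutativeRing using (solve; _:=_; _:+_; _:*_; con)
  open import Relation.Binary.Reasoning.Setoid setoid

  -- The sum is moved inside one argument at a time; after the first, the induction continues with
  -- the form in which that argument is fixed, hence the generality in `D`.
  ∑-tuples-Alternating : ∀ {a} {A : Set a} (as : List A) {m k} {D : Form m k} → Alternating D →
    (g : Fin k → A → Vector Carrier m) →
    ∑[ tuples as k ] (λ y → D (tabulate λ i → g i (lookup y i))) ≈ D (tabulate λ i j → ∑[ as ] λ z → g i z j)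
  ∑-tuples-Alternating as {k = zero}  alt g = +-identityʳ _
  ∑-tuples-Alternating as {m = m} {k = suc k} {D} alt g = begin
    ∑[ tuples as (suc k) ] (λ y → D (tabulate λ i → g i (lookup y i)))
      ≈⟨ ∑-cartesianProductWith _∷_ as (tuples as k) _ ⟩
    ∑[ as ] (λ z → ∑[ tuples as k ] λ y → D (g zero z ∷ tabulate λ i → g (suc i) (lookup y i)))
      ≈⟨ ∑-cong as (λ z → ∑-tuples-Alternating as (fixed alt (g zero z)) (g ∘ suc)) ⟩
    ∑[ as ] (λ z → D (g zero z ∷ rest))
      ≈⟨ head-sum as ⟩
    D ((λ j → ∑[ as ] λ z → g zero z j) ∷ rest) ∎
    where
    rest : Vec (Vector Carrier m) k
    rest = tabulate λ i j → ∑[ as ] λ z → g (suc i) z j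
    head-sum : ∀ bs → ∑[ bs ] (λ z → D (g zero z ∷ rest)) ≈ D ((λ j → ∑[ bs ] λ z → g zero z j) ∷ rest)
    head-sum []       = sym (zero-head alt rest)
    head-sum (z ∷ bs) = trans (+-congˡ (head-sum bs)) (sym (additive alt (g zero z) _ rest))

  ∑-tuples-determinant : ∀ {a} {A : Set a} (as : List A) {k} (g : Fin k → A → Fin k → Carrier) →
    ∑[ tuples as k ] (λ y → determinant λ i → g i (lookup y i)) ≈ determinant (λ i j → ∑[ as ] λ z → g i z j)
  ∑-tuples-determinant as {k} g = begin
    ∑[ tuples as k ] (λ y → determinant λ i → g i (lookup y i))
      ≈⟨ ∑-cong (tuples as k) (λ y → det-tabulate λ i → g i (lookup y i)) ⟨
    ∑[ tuples as k ] (λ y → det (tabulate λ i → g i (lookup y i)))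
      ≈⟨ ∑-tuples-Alternating as det-Alternating g ⟩
    det (tabulate λ i j → ∑[ as ] λ z → g i z j)
      ≈⟨ det-tabulate (λ i j → ∑[ as ] λ z → g i z j) ⟩
    determinant (λ i j → ∑[ as ] λ z → g i z j) ∎

  determinant-zero-row : ∀ {k} (M : Fin k → Fin k → Carrier) i → (∀ j → M i j ≈ 0#) → determinant M ≈ 0#
  determinant-zero-row M i M≈0 = trans (sym (det-tabulate M))
    (zero-argument det-Alternating (tabulate M) i λ j → trans (reflexive (≡.cong (λ u → u j) (Vec.lookup∘tabulate M i))) (M≈0 j))

  HasSum-cong : ∀ {k} {f g : Vec ℤ k → Carrier} {s t} → (∀ y → f y ≈ g y) → s ≈ t → HasSum f s → HasSum g t
  HasSum-cong {k} f≈g s≈t (N , f≈0 , ∑f≈s) =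
    N , (λ y far → trans (sym (f≈g y)) (f≈0 y far)) ,
    trans (sym (∑-cong (tuples (interval N) k) f≈g)) (trans ∑f≈s s≈t)

  module _ (corner : Corner) (k : ℕ) {n} (x : Vector Carrier n) where

    K : ℕ
    K = 2 ℕ.* k ℕ.+ 1

    term : Fin k → ℤ → Fin k → Carrier
    term i y j = parity y * (centred x (position j ℤ.- position i ℤ.- + K ℤ.* y)
      + coefficient corner * centred x (position j ℤ.+ position i ℤ.- offset corner ℤ.- + K ℤ.* y))

    ∑-term : ∀ N i j → ∑[ interval N ] (λ y → term i y j) ≈ entries k N corner x i j
    ∑-term N i j = trans
      (∑-cong (interval N) λ y → trans (distribˡ _ _ _)
        (+-congˡ (solve 3 (λ p s a → p :* (s :* a) := s :* (p :* a)) refl (parity y) (coefficient corner) (second y))))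
      (trans (∑-+ (interval N) (λ y → parity y * centred x (position j ℤ.- position i ℤ.- + K ℤ.* y)) (λ y → coefficient corner * (parity y * second y)))
        (+-congˡ (sym (*-∑ (interval N) (coefficient corner) (λ y → parity y * second y)))))
      where
      second : ℤ → Carrier
      second y = centred x (position j ℤ.+ position i ℤ.- offset corner ℤ.- + K ℤ.* y)

    HasSum-term : Invertible x → HasSum (λ y → determinant λ i → term i (lookup y i))
                    (product λ i → determinant (corner-matrix k corner (x i + x i ⁻¹)))
    HasSum-term inv = N , vanish , (begin
      ∑[ tuples (interval N) k ] (λ y → determinant λ i → term i (lookup y i))
        ≈⟨ ∑-tuples-determinant (interval N) term ⟩
      determinant (λ i j → ∑[ interval N ] λ y → term i y j)
        ≈⟨ determinant-cong (∑-term N) ⟩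
      determinant (entries k N corner x)
        ≈⟨ determinant-entries k N corner x inv (ℕ.n<1+n _) ⟩
      product (λ i → determinant (corner-matrix k corner (x i + x i ⁻¹))) ∎)
      where
      N : ℕ
      -- The least value with `n + 2 * k < N`. It also bounds the support: |r| < K means |r| is at
      -- most 2k, so |y| > N gives K|y| > n + |r|. A single such coordinate of `y` makes a whole row
      -- vanish.
      N = suc (n ℕ.+ 2 ℕ.* k)

      far : ∀ r y → ∣ r ∣ < K → N < ∣ y ∣ → centred x (r ℤ.- + K ℤ.* y) ≈ 0#
      far r y r<K N<y = centred-support x inv (r ℤ.- + K ℤ.* y) (∣r-Ky∣-large K r y (ℕ.≤-<-trans
        (ℕ.+-monoʳ-≤ n (ℕ.≤-pred (≡.subst (∣ r ∣ <_) (ℕ.+-comm (2 ℕ.* k) 1) r<K)))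
        (ℕ.<-≤-trans (ℕ.<-trans (ℕ.n<1+n _) N<y)
          (≡.subst (λ K → ∣ y ∣ ≤ K ℕ.* ∣ y ∣) (ℕ.+-comm 1 (2 ℕ.* k)) (ℕ.m≤m+n ∣ y ∣ _)))))

      vanish : ∀ y → (∃ λ i → N < ∣ lookup y i ∣) → determinant (λ i → term i (lookup y i)) ≈ 0#
      vanish y (i , N<y) = determinant-zero-row (λ i → term i (lookup y i)) i λ j → trans
        (*-congˡ (+-cong (far (position j ℤ.- position i) (lookup y i) (∣j-i∣<K k i j) N<y)
          (*-congˡ (far (position j ℤ.+ position i ℤ.- offset corner) (lookup y i) (∣j+i-offset∣<K k corner i j) N<y))))
        (solve 2 (λ p s → p :* (con (+ 0) :+ s :* con (+ 0)) := con (+ 0)) refl (parity (lookup y i)) (coefficient corner))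

  corner-value : ∀ corner k {z y} → z * y ≈ 1# →
                 (1# - z) * determinant (corner-matrix k corner (z + y)) ≈ y ^ k - z ^ suc k
  corner-value first k zy≈1 = corner-first zy≈1 k
  corner-value last  k zy≈1 = corner-last zy≈1 k

  -- The parameters (0, -1) and (-1, 0) of the two identities both have product 0 and numerator 1 +
  -- z, so one computation covers them and either corner may be compared with either pair.
  P-BC-value : ∀ corner k {n} → 1 ≤ n → (x : Vector Carrier n) → Generic x → ∀ {s₁ s₂} → s₁ * s₂ ≈ 0# →
    (∀ z → (1# - s₁ * z) * (1# - s₂ * z) ≈ 1# + z) →
    product (λ i → determinant (corner-matrix k corner (x i + x i ⁻¹))) ≈ P-BC (rectangle k n) x 1# s₁ s₂
  P-BC-value corner k {n} 1≤n x generic s₁s₂≈0 numerator = sym (trans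
    (P-BC-rectangle x generic k s₁s₂≈0 numerator 1≤n)
    -- Both factors are known only after multiplication by `1# - x i`, which is nonzero because the
    -- square of `x i` is not 1.
    (product-cong {n} λ i → *-cancelˡ (1-xᵢ≉0 x generic k s₁s₂≈0 numerator i) (trans
      (symmetrised-value x generic k s₁s₂≈0 numerator i)
      (sym (corner-value corner k (inverseʳ (Generic.xᵢ≉0 generic i)))))))

lemma4p4 : ∀ {c ℓ} (F : Field c ℓ) → CharacteristicZero F →
  let open Field F
      open Over F
      open RawSemiringDefinitions rawSemiring using (_^_)
  in
  (k n : ℕ) → 1 ≤ n → (x : Vector Carrier n) → Generic x →
  let K = 2 ℕ.* k ℕ.+ 1 in
  HasSum {k}
    (λ y → determinant λ i j →
      (- 1#) ^ ∣ lookup y i ∣ *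
        (ė x (+ n ℤ.- position i ℤ.+ position j ℤ.- + K ℤ.* lookup y i)
         + ė x (+ n ℤ.+ position i ℤ.+ position j ℤ.- + K ℤ.* lookup y i ℤ.- + 1)))
    (P-B (rectangle k n) x 1# 0#)
  ×
  HasSum {k}
    (λ y → determinant λ i j →
      (- 1#) ^ ∣ lookup y i ∣ *
        (ė x (+ n ℤ.- position i ℤ.+ position j ℤ.- + K ℤ.* lookup y i)
         - ė x (+ n ℤ.+ position i ℤ.+ position j ℤ.- + K ℤ.* lookup y i)))
    (P-BC (rectangle k n) x 1# (- 1#) 0#)
lemma4p4 F char0 k n 1≤n x generic =
  HasSum-cong
    (λ y → determinant-cong λ i j → *-congˡ (+-cong
      (ė-≡ (≡.sym (n-i+j-Ky (+ n) (position i) (position j) (+ K′) (lookup y i))))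
      (trans (*-identityˡ _) (ė-≡ (≡.sym (n+i+j-Ky-1 (+ n) (position i) (position j) (+ K′) (lookup y i)))))))
    (P-BC-value first k 1≤n x generic (zeroˡ _)
      (solve 1 (λ z → (con (+ 1) :- con (+ 0) :* z) :* (con (+ 1) :- (:- con (+ 1)) :* z) := con (+ 1) :+ z) refl))
    (HasSum-term first k x inv) ,
  HasSum-cong
    (λ y → determinant-cong λ i j → *-congˡ (+-cong
      (ė-≡ (≡.sym (n-i+j-Ky (+ n) (position i) (position j) (+ K′) (lookup y i))))
      (trans (solve 1 (λ a → :- con (+ 1) :* a := :- a) refl _)
        (-‿cong (ė-≡ (≡.sym (n+i+j-Ky (+ n) (position i) (position j) (+ K′) (lookup y i))))))))
    (P-BC-value last k 1≤n x generic (zeroʳ _)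
      (solve 1 (λ z → (con (+ 1) :- (:- con (+ 1)) :* z) :* (con (+ 1) :- con (+ 0) :* z) := con (+ 1) :+ z) refl))
    (HasSum-term last k x inv)
  where
  open Field F hiding (zero)
  open Over F
  open Determinants F
  open Periodisation F
  open Assembly F char0
  open IntegerCoefficients commutativeRing using (solve; _:=_; _:+_; _:*_; _:-_; :-_; con)
  K′ : ℕ
  K′ = 2 ℕ.* k ℕ.+ 1
  inv : Invertible x
  inv i = inverseʳ (Generic.xᵢ≉0 generic i)
  ė-≡ : ∀ {r s} → r ≡ s → ė x r ≈ ė x s
  ė-≡ eq = reflexive (≡.cong (ė x) eq)
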